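{- Let $m,n\ge1$ and let $\mathcal{C}$ be a simplicial complex on ground set $V$ obtained from $D_{m,n}$ (on vertex set $W\subseteq V$) by a finite sequence of operations, each of which is either $\operatorname{cone}^p(\cdot)$, $G(\cdot)$, or $\Lambda(\cdot)$. Call a vertex a Lawrence vertex if it is the new vertex added by one of the Lawrence liftings $\Lambda(\cdot)$ in this sequence. Let $\mathbf{d}=(d_v)_{v\in V}$ with all $d_v\ge 2$. Then $\mathcal{A}_{\mathcal{C},\mathbf{d}}$ is unimodular if and only if $d_v=2$ for every $v\in W$ and $d_v=2$ for every Lawrence vertex $v$.
   Context: A simplicial complex on a finite ground set $V$ is a family of subsets of $V$ closed under taking subsets; facets are inclusion-maximal faces. For $\mathbf{d}=(d_v)_{v\in V}$ with all $d_v\ge2$, $\mathcal{A}_{\mathcal{C},\mathbf{d}}$ is the $0/1$ matrix with columns indexed by $\mathbf{i}\in\prod_{v\in V}[d_v]$ and rows indexed by pairs $(F,\mathbf{e})$, $F$ a facet, $\mathbf{e}\in\prod_{v\in F}[d_v]$; entry $1$ iff $\mathbf{e}=\mathbf{i}|_F$. An integer matrix $A$ is unimodular if every circuit of $A$ (a nonzero integer vector in $\ker A$ with relatively prime entries and inclusion-minimal support among nonzero kernel vectors) has all entries in $\{0,\pm1\}$. $\Delta_k$ is the complex on a $(k+1)$-set with that set as its only facet; $\Delta_m\sqcup\Delta_n$ is the disjoint union; the Alexander dual of $\mathcal{C}$ on $V$ is $\{S\subseteq V: V\setminus S\notin\mathcal{C}\}$, and $D_{m,n}=(\Delta_m\sqcup\Delta_n)^*$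 (on $m+n+2$ vertices; its facets are the sets omitting exactly one vertex of each of the two blocks). $\operatorname{cone}^p(\mathcal{C})$ adds $p$ new vertices $u_1,\dots,u_p$ and has facets $F\cup\{u_1,\dots,u_p\}$; $G(\mathcal{C})$ is $\mathcal{C}$ with one new vertex added to the ground set lying in no face; for $\mathcal{C}$ on $[n]$, $\Lambda(\mathcal{C})$ is the complex on $[n+1]$ with facets $[n]$ and $F\cup\{n+1\}$ for $F$ a facet of $\mathcal{C}$. -}

module Defs where

open import Data.Bool.Base using (if_then_else_)
open import Data.Fin.Base using (Fin)
import Data.Fin.Properties as Fin
open import Data.Fin.Subset
  using (Subset; inside; outside; ⊥; ⊤; _⊆_; ∁; ∣_∣)
open import Data.Fin.Subset.Properties
  using (⊆-trans; ⊆-antisym; ⊥⊆; drop-∷-⊆; s⊆s; out⊆; x∉p⇒x∈∁p; x∈∁p⇒x∉p)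
open import Data.Integer.Base as ℤ using (ℤ; 0ℤ; 1ℤ; -1ℤ)
open import Data.List.Base as List using (List; allFin; cartesianProductWith; foldr)
import Data.List.Membership.Propositional as List
open import Data.List.Membership.Propositional.Properties
  using (∈-cartesianProductWith⁺; ∈-allFin)
import Data.List.Relation.Unary.All as ListAll
import Data.List.Relation.Unary.AllPairs as AllPairs
open import Data.List.Relation.Unary.Any using (here)
open import Data.List.Relation.Unary.Unique.Propositional using (Unique)
open import Data.List.Relation.Unary.Unique.Propositional.Properties
  using (cartesianProductWith⁺; allFin⁺)
open import Data.Nat.Base using (ℕ; suc; _+_)
open import Data.Nat.Divisibility using (_∣_)
open import Data.Product.Base using (Σ; ∃; _×_; _,_; uncurry)
open import Data.Sum.Base using (_⊎_; inj₁; inj₂)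
open import Data.Vec.Base using (Vec; []; _∷_; _++_; here)
open import Data.Vec.Relation.Unary.All using (All; []; _∷_)
open import Function.Base using (_∘_; id)
open import Relation.Binary.Definitions using (DecidableEquality)
open import Relation.Binary.PropositionalEquality using (_≡_; _≢_; refl; cong; cong₂)
open import Relation.Nullary using (¬_; does; yes)
open import Relation.Nullary.Decidable using (map′; _×-dec_)

private
  variable
    k l : ℕ

-- Ground sets are the standard finite sets Fin k.
record Complex (k : ℕ) : Set₁ where
  field
    Face        : Subset k → Set
    down-closed : ∀ {S T} → S ⊆ T → Face T → Face S

open Complex public

Facet : Complex k → Subset k → Set
Facet C F = Face C F × (∀ T → Face C T → F ⊆ T → T ⊆ F)

-- The smallest complex containing a given family.  If the family is an
-- antichain, its members are exactly the facets.
generatedBy : (Subset k → Set) → Complex k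
generatedBy P .Face S = ∃ λ T → P T × S ⊆ T
generatedBy P .down-closed S⊆T (U , PU , T⊆U) = U , PU , ⊆-trans S⊆T T⊆U

Δ : ∀ n → Complex (suc n)
Δ n = generatedBy (_≡ ⊤)

private
  ⊆-++⊥ : ∀ (S : Subset k) {T : Subset (k + l)} → T ⊆ S ++ ⊥ →
          ∃ λ T₁ → T₁ ⊆ S × T ≡ T₁ ++ ⊥
  ⊆-++⊥ [] T⊆ = [] , id , ⊆-antisym T⊆ ⊥⊆
  ⊆-++⊥ (s ∷ S) {outside ∷ T} T⊆ with ⊆-++⊥ S (drop-∷-⊆ T⊆)
  ... | T₁ , T₁⊆S , refl = outside ∷ T₁ , out⊆ T₁⊆S , refl
  ⊆-++⊥ (s ∷ S) {inside ∷ T} T⊆ with ⊆-++⊥ S (drop-∷-⊆ T⊆) | T⊆ here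
  ... | T₁ , T₁⊆S , refl | here = inside ∷ T₁ , s⊆s T₁⊆S , refl

  ⊆-⊥++ : ∀ k {S : Subset l} {T : Subset (k + l)} → T ⊆ ⊥ {k} ++ S →
          ∃ λ T₂ → T₂ ⊆ S × T ≡ ⊥ {k} ++ T₂
  ⊆-⊥++ 0 {T = T} T⊆ = T , T⊆ , refl
  ⊆-⊥++ (suc k) {T = outside ∷ T} T⊆ with ⊆-⊥++ k (drop-∷-⊆ T⊆)
  ... | T₂ , T₂⊆S , refl = T₂ , T₂⊆S , refl
  ⊆-⊥++ (suc k) {T = inside ∷ T} T⊆ with T⊆ here
  ... | ()

infixr 6 _⊔_

_⊔_ : Complex k → Complex l → Complex (k + l)
_⊔_ {k} C₁ C₂ .Face S = (∃ λ S₁ → Face C₁ S₁ × S ≡ S₁ ++ ⊥)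
                      ⊎ (∃ λ S₂ → Face C₂ S₂ × S ≡ ⊥ {k} ++ S₂)
_⊔_ {k} C₁ C₂ .down-closed T⊆S (inj₁ (S₁ , f , refl)) with ⊆-++⊥ S₁ T⊆S
... | T₁ , T₁⊆S₁ , eq = inj₁ (T₁ , down-closed C₁ T₁⊆S₁ f , eq)
_⊔_ {k} C₁ C₂ .down-closed T⊆S (inj₂ (S₂ , f , refl)) with ⊆-⊥++ k T⊆S
... | T₂ , T₂⊆S₂ , eq = inj₂ (T₂ , down-closed C₂ T₂⊆S₂ f , eq)

infix 8 _*

_* : Complex k → Complex k
(C *) .Face S = ¬ Face C (∁ S)
(C *) .down-closed S⊆T ¬f f =
  ¬f (down-closed C (λ x∈∁T → x∉p⇒x∈∁p (x∈∁p⇒x∉p x∈∁T ∘ S⊆T)) f)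

-- The first m + 1 vertices form one block, the last n + 1 the other.
D : ∀ m n → Complex (suc m + suc n)
D m n = (Δ m ⊔ Δ n) *

-- In cone, G and Λ the new vertices come first (so the Lawrence vertex is 0,
-- not the last one) and the old vertices are shifted up.

cone : ∀ p → Complex k → Complex (p + k)
cone p C = generatedBy λ T → ∃ λ F → Facet C F × T ≡ ⊤ {p} ++ F

G : Complex k → Complex (suc k)
G C .Face S = ∃ λ S′ → Face C S′ × S ≡ outside ∷ S′
G C .down-closed {S = outside ∷ S} S⊆T (T , f , refl) =
  S , down-closed C (drop-∷-⊆ S⊆T) f , refl
G C .down-closed {S = inside ∷ S} S⊆T (T , f , refl) with S⊆T here
... | ()

Λ : Complex k → Complex (suc k)
Λ C = generatedBy λ T → T ≡ outside ∷ ⊤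
                      ⊎ (∃ λ F → Facet C F × T ≡ inside ∷ F)

-- Obtained m n C W L: the complex C arises from D m n by a finite sequence of
-- cones, G's and Λ's, in such a way that W is the set of vertices coming from
-- D m n and L is the set of Lawrence vertices.
data Obtained (m n : ℕ) : Complex k → Subset k → Subset k → Set₁ where
  base      : Obtained m n (D m n) ⊤ ⊥
  cone-step : ∀ p {C : Complex k} {W L} → Obtained m n C W L →
              Obtained m n (cone p C) (⊥ {p} ++ W) (⊥ {p} ++ L)
  G-step    : ∀ {C : Complex k} {W L} → Obtained m n C W L →
              Obtained m n (G C) (outside ∷ W) (outside ∷ L)
  Λ-step    : ∀ {C : Complex k} {W L} → Obtained m n C W L →
              Obtained m n (Λ C) (outside ∷ W) (inside ∷ L)

-- Columns are listed once each, so that sums over them make sense; no sum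
-- over rows is needed, so rows may be any type.
record Matrix : Set₁ where
  field
    Row Col   : Set
    columns   : List Col
    complete  : ∀ c → c List.∈ columns
    unique    : Unique columns
    entry     : Row → Col → ℤ

  ∑ : (Col → ℤ) → ℤ
  ∑ f = foldr (λ c s → f c ℤ.+ s) 0ℤ columns

  InKernel : (Col → ℤ) → Set
  InKernel x = ∀ r → ∑ (λ c → entry r c ℤ.* x c) ≡ 0ℤ

  Nonzero : (Col → ℤ) → Set
  Nonzero x = ∃ λ c → x c ≢ 0ℤ

  RelativelyPrime : (Col → ℤ) → Set
  RelativelyPrime x = ∀ g → (∀ c → g ∣ ℤ.∣ x c ∣) → g ≡ 1

  -- Inclusion of supports.
  _⊆supp_ : (Col → ℤ) → (Col → ℤ) → Set
  y ⊆supp x = ∀ c → y c ≢ 0ℤ → x c ≢ 0ℤ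

  record IsCircuit (x : Col → ℤ) : Set where
    field
      inKernel        : InKernel x
      nonzero         : Nonzero x
      relativelyPrime : RelativelyPrime x
      minimal         : ∀ y → InKernel y → Nonzero y →
                        y ⊆supp x → x ⊆supp y

  Unimodular : Set
  Unimodular = ∀ x → IsCircuit x → ∀ c → x c ≡ 0ℤ ⊎ x c ≡ 1ℤ ⊎ x c ≡ -1ℤ

open Matrix public using (Unimodular)

-- Elements of ∏ᵥ [dᵥ].
Cell : Vec ℕ k → Set
Cell = All Fin

private
  ∷-injective : ∀ {n} {ns : Vec ℕ k} {i j : Fin n} {is js : Cell ns} →
                _≡_ {A = Cell (n ∷ ns)} (i ∷ is) (j ∷ js) → i ≡ j × is ≡ js
  ∷-injective refl = refl , refl

infix 4 _≟_

_≟_ : {d : Vec ℕ k} → DecidableEquality (Cell d)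
[]       ≟ []       = yes refl
(i ∷ is) ≟ (j ∷ js) =
  map′ (uncurry (cong₂ _∷_)) ∷-injective (i Fin.≟ j ×-dec is ≟ js)

allCells : (d : Vec ℕ k) → List (Cell d)
allCells []      = List.[ [] ]
allCells (n ∷ d) = cartesianProductWith _∷_ (allFin n) (allCells d)

allCells-complete : {d : Vec ℕ k} (i : Cell d) → i List.∈ allCells d
allCells-complete []       = here refl
allCells-complete (i ∷ is) =
  ∈-cartesianProductWith⁺ _∷_ (∈-allFin i) (allCells-complete is)

allCells-unique : (d : Vec ℕ k) → Unique (allCells d)
allCells-unique []      = ListAll.[] AllPairs.∷ AllPairs.[]
allCells-unique (n ∷ d) =
  cartesianProductWith⁺ _∷_ ∷-injective (allFin⁺ n) (allCells-unique d)

-- The subfamily (dᵥ) for v ∈ F, so that Cell (select F d) is ∏_{v ∈ F} [dᵥ].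
select : (F : Subset k) → Vec ℕ k → Vec ℕ ∣ F ∣
select []            []      = []
select (inside  ∷ F) (n ∷ d) = n ∷ select F d
select (outside ∷ F) (n ∷ d) = select F d

restrict : (F : Subset k) {d : Vec ℕ k} → Cell d → Cell (select F d)
restrict []            []       = []
restrict (inside  ∷ F) (i ∷ is) = i ∷ restrict F is
restrict (outside ∷ F) (i ∷ is) = restrict F is

𝒜 : Complex k → Vec ℕ k → Matrix
𝒜 C d = record
  { Row      = Σ (Subset _) λ F → Facet C F × Cell (select F d)
  ; Col      = Cell d
  ; columns  = allCells d
  ; complete = allCells-complete
  ; unique   = allCells-unique d
  ; entry    = λ { (F , _ , e) i → if does (e ≟ restrict F i) then 1ℤ else 0ℤ }
  }

{-# OPTIONS --safe #-}
module Submission where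

-- The kernels of the matrices 𝒜 C d are handled as subspaces of ℤ-valued
-- functions.  Unimodularity of a matrix depends only on its kernel and passes
-- to minors, that is, to restrictions of supports and to coordinate
-- projections.  Coning gives a direct sum of copies of the kernel, G pulls it
-- back along a sum of slices, and Λ gives its d-th Lawrence lifting; each has
-- the old kernel as a minor, and each preserves unimodularity, Λ for d = 2.
-- For binary d the kernel of D m n is, up to signs, the cut space of a complete
-- bipartite graph, and cutting potentials at a threshold shows that it is
-- unimodular.  Conversely, since m , n ≥ 1, a non-binary vertex of D m n leads
-- to the minor D 1 1 with d = (3,2,2,2), and a non-binary Lawrence vertex to
-- the third Lawrence lifting of the binary D 1 1; each of these has a kernel
-- vector x with entries x s = 1 and x f = −2 such that y f = −2 y s for every
-- kernel vector y supported in the support of x.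

open import Defs hiding (_*)
open import Data.Bool.Base using (Bool; true; _∧_; not; if_then_else_)
open import Data.Fin.Base as Fin using (Fin; zero; suc; _↑ˡ_; _↑ʳ_)
open import Data.Fin.Patterns using (0F; 1F; 2F)
import Data.Fin.Properties as Fin
open import Data.Fin.Subset using (Subset; inside; outside; ⊥; ⊤; _⊆_; _∈_; ∁)
open import Data.Fin.Subset.Properties
  using (⊆-antisym; ⊆-refl; ⊆-trans; ⊆⊤; ⊥⊆; ∈⊤; ∉⊥; drop-∷-⊆; s⊆s; out⊆)
open import Data.Integer.Base as ℤ using (ℤ; 0ℤ; 1ℤ; -1ℤ; _+_; _*_; -_; _-_; -[1+_])
open import Data.Integer.Divisibility.Signed using (∣ᵤ⇒∣) renaming (_∣_ to _∣ˢ_)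
import Data.Integer.Properties as ℤ
open import Data.Integer.Tactic.RingSolver using (solve-∀)
open import Algebra.Properties.Semiring.Sum ℤ.+-*-semiring
  using (sum; sum-cong-≗; ∑-distrib-+; ∑-comm; *-distribˡ-sum; *-distribʳ-sum; sum-replicate-zero)
open import Data.List.Base as List using (List; []; _∷_)
open import Data.List.Membership.Propositional using () renaming (_∈_ to _∈ˡ_)
import Data.List.Properties as List
import Data.List.Relation.Unary.Any as Any
open import Data.Nat.Base as ℕ using (ℕ; zero; suc; _≤_; _≤′_; ≤′-refl; ≤′-step; z≤n; s≤s)
import Data.Nat.Divisibility as ℕ
import Data.Nat.Properties as ℕ
open import Data.Product.Base using (∃; _×_; _,_; proj₁; proj₂; uncurry; swap)
open import Data.Sum.Base using (_⊎_; inj₁; inj₂; [_,_]′)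
open import Data.Vec.Base using (Vec; []; _∷_; lookup; _++_; drop; splitAt; here; there)
import Data.Vec.Properties as Vec
open import Data.Vec.Relation.Unary.All using (All; []; _∷_)
open import Data.Vec.Relation.Unary.All.Properties using (++⁺; ++↔)
open import Function.Base using (_∘_; id)
open import Function.Bundles using (_↔_; _⇔_; mk↔ₛ′; mk⇔; module Inverse)
open import Relation.Binary.Definitions using (DecidableEquality)
open import Relation.Binary.PropositionalEquality
open import Relation.Nullary using (¬_; Dec; does; yes; no; contradiction)
open import Relation.Nullary.Decidable
  using (_⊎-dec_; decidable-stable; dec-true; dec-false; toWitness)

-- `Face` is an arbitrary predicate, so neither facets nor membership in a kernel can be decided,
-- and a circuit below a given kernel vector cannot be computed. `Regular` therefore asks only for a
-- sign vector, with no minimality or gcd condition to carry along minors, and only under a double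
-- negation. The negation is finally discharged where the goal is decidable: that an integer is a
-- sign, or that some entry of `d` is 2. The value 2 matters because a block with binary `d` has an
-- `Ends` space of rank one, spanned by a parity sign; this is what turns kernel vectors of `D m n`
-- into differences of two potentials. `Λ` acts on kernels as a Lawrence lifting because the full
-- vertex set is never a face, an invariant that has to be carried along the whole construction.

private
  variable
    A B E : Set
    k k′ l n n′ : ℕ

-- Subspaces and their minors

sum-zero : ∀ {f : Fin n → ℤ} → (∀ j → f j ≡ 0ℤ) → sum f ≡ 0ℤ
sum-zero {n} f≡0 = trans (sum-cong-≗ f≡0) (sum-replicate-zero n)

sum-linear : ∀ a b (f g : Fin n → ℤ) →
             sum (λ j → a * f j + b * g j) ≡ a * sum f + b * sum g
sum-linear a b f g = trans (∑-distrib-+ (λ j → a * f j) (λ j → b * g j))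
  (cong₂ _+_ (sym (*-distribˡ-sum a f)) (sym (*-distribˡ-sum b g)))

linear-zero : ∀ a b {u v} → u ≡ 0ℤ → v ≡ 0ℤ → a * u + b * v ≡ 0ℤ
linear-zero a b refl refl = cong₂ _+_ (ℤ.*-zeroʳ a) (ℤ.*-zeroʳ b)

stable : ∀ {z w : ℤ} → ¬ (z ≢ w) → z ≡ w
stable {z} {w} = decidable-stable (z ℤ.≟ w)

≢-factorˡ : ∀ z w → z * w ≢ 0ℤ → z ≢ 0ℤ
≢-factorˡ z w zw≢0 refl = zw≢0 refl

≢-factorʳ : ∀ z w → z * w ≢ 0ℤ → w ≢ 0ℤ
≢-factorʳ z w zw≢0 refl = zw≢0 (ℤ.*-zeroʳ z)

*-≢0 : ∀ {z w} → z ≢ 0ℤ → w ≢ 0ℤ → z * w ≢ 0ℤ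
*-≢0 {z} z≢0 w≢0 eq = [ z≢0 , w≢0 ]′ (ℤ.i*j≡0⇒i≡0∨j≡0 z eq)

IsSign : ℤ → Set
IsSign z = z ≡ 0ℤ ⊎ z ≡ 1ℤ ⊎ z ≡ -1ℤ

*-isSign : ∀ {z w} → IsSign z → IsSign w → IsSign (z * w)
*-isSign (inj₁ refl) _ = inj₁ refl
*-isSign (inj₂ (inj₁ refl)) s = subst IsSign (sym (ℤ.*-identityˡ _)) s
*-isSign (inj₂ (inj₂ refl)) (inj₁ refl) = inj₁ refl
*-isSign (inj₂ (inj₂ refl)) (inj₂ (inj₁ refl)) = inj₂ (inj₂ refl)
*-isSign (inj₂ (inj₂ refl)) (inj₂ (inj₂ refl)) = inj₂ (inj₁ refl)

IsBit : ℤ → Set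
IsBit z = z ≡ 0ℤ ⊎ z ≡ 1ℤ

bit⇒sign : ∀ {z} → IsBit z → IsSign z
bit⇒sign (inj₁ eq) = inj₁ eq
bit⇒sign (inj₂ eq) = inj₂ (inj₁ eq)

bit-difference : ∀ {z w} → IsBit z → IsBit w → IsSign (z - w)
bit-difference (inj₁ refl) (inj₁ refl) = inj₁ refl
bit-difference (inj₁ refl) (inj₂ refl) = inj₂ (inj₂ refl)
bit-difference (inj₂ refl) (inj₁ refl) = inj₂ (inj₁ refl)
bit-difference (inj₂ refl) (inj₂ refl) = inj₁ refl

infix 4 _⊑_

_⊑_ : (A → ℤ) → (A → ℤ) → Set
y ⊑ x = ∀ c → y c ≢ 0ℤ → x c ≢ 0ℤ

⊑-zero : ∀ {y x : A → ℤ} → y ⊑ x → ∀ {c} → x c ≡ 0ℤ → y c ≡ 0ℤ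
⊑-zero y⊑x x≡0 = stable λ y≢0 → y⊑x _ y≢0 x≡0



record Space (A : Set) : Set₁ where
  infix 4 _∋_
  field
    _∋_      : (A → ℤ) → Set
    respects : ∀ {x y} → x ≗ y → _∋_ x → _∋_ y
    linear   : ∀ a b {x y} → _∋_ x → _∋_ y → _∋_ (λ c → a * x c + b * y c)

  scale : ∀ z {x} → _∋_ x → _∋_ (λ c → z * x c)
  scale z x∈ = respects (λ c → ℤ.+-identityʳ _) (linear z 0ℤ x∈ x∈)

  ∋-zero : ∀ {x y} → _∋_ x → (∀ c → y c ≡ 0ℤ) → _∋_ y
  ∋-zero x∈ y≡0 = respects (λ c → sym (y≡0 c)) (scale 0ℤ x∈)

open Space

-- The supports of the sign vectors of K are cofinal among those of K: this is
-- unimodularity, up to a double negation that makes it provable without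
-- eliminating on K.
Regular : Space A → Set
Regular {A} K = ∀ x → K ∋ x → ∀ c → x c ≢ 0ℤ →
  ¬ ¬ (∃ λ y → K ∋ y × (∀ c → IsSign (y c)) × y c ≢ 0ℤ × y ⊑ x)

reindex : A ↔ B → Space A → Space B
reindex f K = record
  { _∋_   = λ x → K ∋ (x ∘ to)
  ; respects = λ x≗y → respects K (x≗y ∘ to)
  ; linear   = λ a b → linear K a b }
  where open Inverse f

infix 4 _≐_

record _≐_ (K K′ : Space A) : Set where
  constructor equal
  field
    to   : ∀ {x} → K ∋ x → K′ ∋ x
    from : ∀ {x} → K′ ∋ x → K ∋ x

≐-refl : {K : Space A} → K ≐ K
≐-refl = equal id id

≐-sym : {K K′ : Space A} → K ≐ K′ → K′ ≐ K
≐-sym (equal to from) = equal from to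

≐-trans : {K K′ K″ : Space A} → K ≐ K′ → K′ ≐ K″ → K ≐ K″
≐-trans (equal to from) (equal to′ from′) = equal (to′ ∘ to) (from ∘ from′)

-- K′ arises from K by deleting some coordinates and contracting others.  The
-- section x ↦ ε · (x ∘ π) of the deletion y ↦ y ∘ ι is kept explicit because
-- its coordinatewise form makes it compatible with Lawrence liftings.
record Minor (K : Space A) (K′ : Space B) : Set where
  field
    ι        : B → A
    π        : A → B
    ε        : A → ℤ
    π∘ι      : ∀ b → π (ι b) ≡ b
    ε∘ι      : ∀ b → ε (ι b) ≡ 1ℤ
    extend   : ∀ {x} → K′ ∋ x → K ∋ (λ a → ε a * x (π a))
    project : ∀ {y} → K ∋ y → y ⊑ ε → K′ ∋ (y ∘ ι)

open Minor

extend-ι : ∀ {K : Space A} {K′ : Space B} (m : Minor K K′) (x : B → ℤ) b →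
           ε m (ι m b) * x (π m (ι m b)) ≡ x b
extend-ι m x b = trans (cong₂ (λ e b → e * x b) (ε∘ι m b) (π∘ι m b)) (ℤ.*-identityˡ _)

-- A sign vector found below the extension of `x` is supported within `ε`, so `project` applies to
-- it.
regular-minor : {K : Space A} {K′ : Space B} → Minor K K′ → Regular K → Regular K′
regular-minor m reg x x∈ c xc≢0 k =
  reg _ (extend m x∈) (ι m c) (xc≢0 ∘ trans (sym (extend-ι m x c)))
    λ { (y , y∈ , sgn , yc≢0 , y⊑) → k
      ( y ∘ ι m
      , project m y∈ (λ a ya≢0 → ≢-factorˡ (ε m a) _ (y⊑ a ya≢0))
      , sgn ∘ ι m , yc≢0
      , λ b yb≢0 → y⊑ (ι m b) yb≢0 ∘ trans (extend-ι m x b) ) }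

≐⇒minor : {K K′ : Space A} → K ≐ K′ → Minor K K′
≐⇒minor {K = K} (equal to from) = record
  { ι = id ; π = id ; ε = λ _ → 1ℤ ; π∘ι = λ _ → refl ; ε∘ι = λ _ → refl
  ; extend = λ x∈ → scale K 1ℤ (from x∈)
  ; project = λ y∈ _ → to y∈ }

minor-trans : {K : Space A} {K′ : Space B} {K″ : Space E} →
              Minor K K′ → Minor K′ K″ → Minor K K″
minor-trans {K = K} p q = record
  { ι = ι p ∘ ι q
  ; π = π q ∘ π p
  ; ε = λ a → ε p a * ε q (π p a)
  ; π∘ι = λ b → trans (cong (π q) (π∘ι p _)) (π∘ι q b)
  ; ε∘ι = λ b → trans (extend-ι p (ε q) (ι q b)) (ε∘ι q b)
  ; extend = λ {x} x∈ → respects K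
      (λ a → sym (ℤ.*-assoc (ε p a) (ε q (π p a)) (x (π q (π p a)))))
      (extend p (extend q x∈))
  ; project = λ {y} y∈ y⊑ →
      project q (project p y∈ λ a ya≢0 → ≢-factorˡ (ε p a) _ (y⊑ a ya≢0))
        λ b yb≢0 εb≡0 → y⊑ (ι p b) yb≢0 (trans (extend-ι p (ε q) b) εb≡0)
  }

reindex-minor : (f : A ↔ B) {K : Space A} → Minor (reindex f K) K
reindex-minor f {K} = record
  { ι = to ; π = from ; ε = λ _ → 1ℤ ; π∘ι = strictlyInverseʳ ; ε∘ι = λ _ → refl
  ; extend = λ {x} x∈ → respects K
      (λ a → trans (cong x (sym (strictlyInverseʳ a))) (sym (ℤ.*-identityˡ _))) x∈
  ; project = λ y∈ _ → y∈ }
  where open Inverse f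

minor-reindex : (f : A ↔ B) {K : Space A} → Minor K (reindex f K)
minor-reindex f {K} = record
  { ι = from ; π = to ; ε = λ _ → 1ℤ ; π∘ι = strictlyInverseˡ ; ε∘ι = λ _ → refl
  ; extend = scale K 1ℤ
  ; project = λ {y} y∈ _ → respects K (λ a → cong y (sym (strictlyInverseʳ a))) y∈ }
  where open Inverse f

-- The effect of cone, G and Λ on kernels

Slices : ∀ n → Space A → Space (Fin n × A)
Slices n K = record
  { _∋_      = λ x → ∀ j → K ∋ (λ a → x (j , a))
  ; respects = λ x≗y x∈ j → respects K (λ a → x≗y (j , a)) (x∈ j)
  ; linear   = λ s t x∈ y∈ j → linear K s t (x∈ j) (y∈ j) }

Total : ∀ n → Space A → Space (Fin n × A)
Total n K = record
  { _∋_      = λ x → K ∋ (λ a → sum λ j → x (j , a))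
  ; respects = λ x≗y → respects K (λ a → sum-cong-≗ {n} (λ j → x≗y (j , a)))
  ; linear   = λ s t {x} {y} x∈ y∈ → respects K
      (λ a → sym (sum-linear s t (λ j → x (j , a)) (λ j → y (j , a)))) (linear K s t x∈ y∈) }

Lawrence : ∀ n → Space A → Space (Fin n × A)
Lawrence n K = record
  { _∋_      = λ x → (∀ j → K ∋ (λ a → x (j , a))) × (∀ a → sum (λ j → x (j , a)) ≡ 0ℤ)
  ; respects = λ x≗y (x∈ , x0) →
      (λ j → respects K (λ a → x≗y (j , a)) (x∈ j)) ,
      λ a → trans (sum-cong-≗ {n} (λ j → sym (x≗y (j , a)))) (x0 a)
  ; linear   = λ s t {x} {y} (x∈ , x0) (y∈ , y0) →
      (λ j → linear K s t (x∈ j) (y∈ j)) ,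
      λ a → trans (sum-linear s t (λ j → x (j , a)) (λ j → y (j , a)))
                  (linear-zero s t (x0 a) (y0 a)) }

δ : Fin n → Fin n → ℤ
δ zero    zero    = 1ℤ
δ zero    (suc _) = 0ℤ
δ (suc _) zero    = 0ℤ
δ (suc i) (suc j) = δ i j

δ-refl : ∀ (j : Fin n) → δ j j ≡ 1ℤ
δ-refl zero    = refl
δ-refl (suc j) = δ-refl j

δ-≢0 : ∀ (i j : Fin n) → δ i j ≢ 0ℤ → i ≡ j
δ-≢0 zero    zero    _  = refl
δ-≢0 zero    (suc j) ≢0 = contradiction refl ≢0
δ-≢0 (suc i) zero    ≢0 = contradiction refl ≢0
δ-≢0 (suc i) (suc j) ≢0 = cong suc (δ-≢0 i j ≢0)

δ-≢ : ∀ (i j : Fin n) → i ≢ j → δ i j ≡ 0ℤ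
δ-≢ i j i≢j = stable (i≢j ∘ δ-≢0 i j)

δ-isBit : ∀ (i j : Fin n) → IsBit (δ i j)
δ-isBit zero    zero    = inj₂ refl
δ-isBit zero    (suc j) = inj₁ refl
δ-isBit (suc i) zero    = inj₁ refl
δ-isBit (suc i) (suc j) = δ-isBit i j

sum-δ : ∀ (i : Fin n) → sum (δ i) ≡ 1ℤ
sum-δ {suc n} zero    = cong (1ℤ +_) (sum-replicate-zero n)
sum-δ         (suc i) = trans (ℤ.+-identityˡ _) (sum-δ i)

sum-δ-* : ∀ (i : Fin n) z → sum (λ j → δ i j * z) ≡ z
sum-δ-* i z = begin
  sum (λ j → δ i j * z) ≡⟨ *-distribʳ-sum z (δ i) ⟨
  sum (δ i) * z         ≡⟨ cong (_* z) (sum-δ i) ⟩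
  1ℤ * z                ≡⟨ ℤ.*-identityˡ z ⟩
  z                     ∎
  where open ≡-Reasoning

sum-concentrated : ∀ i (f : Fin n → ℤ) → f ⊑ δ i → sum f ≡ f i
sum-concentrated i f f⊑ = trans (sum-cong-≗ eq) (sum-δ-* i (f i))
  where
  eq : ∀ j → f j ≡ δ i j * f i
  eq j with i Fin.≟ j
  ... | yes refl = sym (trans (cong (_* f i) (δ-refl i)) (ℤ.*-identityˡ _))
  ... | no i≢j   = trans (⊑-zero f⊑ (δ-≢ i j i≢j)) (sym (cong (_* f i) (δ-≢ i j i≢j)))

slices-minor : {K : Space A} → Minor (Slices (suc n) K) K
slices-minor {K = K} = record
  { ι = zero ,_ ; π = proj₂ ; ε = λ (j , _) → δ zero j ; π∘ι = λ _ → refl ; ε∘ι = λ _ → refl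
  ; extend = λ x∈ j → scale K (δ zero j) x∈
  ; project = λ y∈ _ → y∈ zero }

total-minor : {K : Space A} → Minor (Total (suc n) K) K
total-minor {n = n} {K = K} = record
  { ι = zero ,_ ; π = proj₂ ; ε = λ (j , _) → δ zero j ; π∘ι = λ _ → refl ; ε∘ι = λ _ → refl
  ; extend = λ {x} x∈ → respects K (λ a → sym (sum-δ-* {suc n} zero (x a))) x∈
  ; project = λ {y} y∈ y⊑ → respects K
      (λ a → sum-concentrated zero (λ j → y (j , a)) (λ j → y⊑ (j , a))) y∈ }

lawrence-minor : {K : Space A} → Minor (Lawrence (suc (suc n)) K) K
lawrence-minor {n = n} {K = K} = record
  { ι = zero ,_ ; π = proj₂ ; ε = λ (j , _) → σ j ; π∘ι = λ _ → refl ; ε∘ι = λ _ → refl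
  ; extend = λ {x} x∈ → (λ j → scale K (σ j) x∈) ,
      λ a → trans (sym (*-distribʳ-sum (x a) σ)) (cong (_* x a) sum-σ)
  ; project = λ y∈ _ → proj₁ y∈ zero }
  where
  -- The section puts `x` in slice 0 and its negative in slice 1, so that the slices cancel.
  σ : Fin (suc (suc n)) → ℤ
  σ zero          = 1ℤ
  σ (suc zero)    = -1ℤ
  σ (suc (suc _)) = 0ℤ

  sum-σ : sum σ ≡ 0ℤ
  sum-σ = cong (λ z → 1ℤ + (-1ℤ + z)) (sum-replicate-zero n)

-- The one-vertex counterpart of `Minor`: levels of a vertex are dropped in a way that respects sums
-- over that vertex.
record Truncation (n n′ : ℕ) : Set where
  field
    ι        : Fin n′ → Fin n
    π        : Fin n → Fin n′
    ε        : Fin n → ℤ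
    π∘ι      : ∀ j → π (ι j) ≡ j
    ε∘ι      : ∀ j → ε (ι j) ≡ 1ℤ
    extend   : ∀ x → sum (λ j → ε j * x (π j)) ≡ sum x
    project : ∀ y → y ⊑ ε → sum (y ∘ ι) ≡ sum y

truncation : suc n′ ≤′ n → Truncation n (suc n′)
truncation ≤′-refl = record
  { ι = id ; π = id ; ε = λ _ → 1ℤ ; π∘ι = λ _ → refl ; ε∘ι = λ _ → refl
  ; extend = λ x → sum-cong-≗ (λ j → ℤ.*-identityˡ (x j))
  ; project = λ _ _ → refl }
truncation (≤′-step le) = record
  { ι = suc ∘ t.ι
  -- The dropped level is sent to an arbitrary kept one; `ε′` vanishes there.
  ; π = λ { zero → zero ; (suc j) → t.π j }
  ; ε = ε′
  ; π∘ι = t.π∘ι ; ε∘ι = t.ε∘ι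
  ; extend = λ x → trans (ℤ.+-identityˡ _) (t.extend x)
  ; project = λ y y⊑ → trans (t.project (y ∘ suc) (λ j → y⊑ (suc j)))
      (sym (trans (cong (_+ sum (y ∘ suc)) (⊑-zero {x = ε′} y⊑ {zero} refl)) (ℤ.+-identityˡ _))) }
  where
  module t = Truncation (truncation le)
  ε′ : Fin _ → ℤ
  ε′ zero = 0ℤ
  ε′ (suc j) = t.ε j

-- The product of the two sections. The factor `m.ε a` does not depend on the slice, so it can be
-- pulled out of the sum over slices.
lawrence-cong : {K : Space A} {K′ : Space B} → Truncation n n′ → Minor K K′ →
                Minor (Lawrence n K) (Lawrence n′ K′)
lawrence-cong {n = n} {n′ = n′} {K = K} {K′} t m = record
  { ι = λ (j , b) → t.ι j , m.ι b
  ; π = λ (j , a) → t.π j , m.π a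
  ; ε = λ (j , a) → t.ε j * m.ε a
  ; π∘ι = λ (j , b) → cong₂ _,_ (t.π∘ι j) (m.π∘ι b)
  ; ε∘ι = λ (j , b) → cong₂ _*_ (t.ε∘ι j) (m.ε∘ι b)
  ; extend = λ {x} (x∈ , x0) →
      (λ j → respects K (λ a → sym (ℤ.*-assoc (t.ε j) (m.ε a) _))
               (scale K (t.ε j) (m.extend (x∈ (t.π j))))) ,
      λ a → begin
        sum (λ j → t.ε j * m.ε a * x (t.π j , m.π a))
          ≡⟨ sum-cong-≗ (λ j → rotate (t.ε j) (m.ε a) (x (t.π j , m.π a))) ⟩
        sum (λ j → m.ε a * (t.ε j * x (t.π j , m.π a)))
          ≡⟨ *-distribˡ-sum (m.ε a) (λ j → t.ε j * x (t.π j , m.π a)) ⟨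
        m.ε a * sum (λ j → t.ε j * x (t.π j , m.π a))
          ≡⟨ cong (m.ε a *_) (trans (t.extend (λ j → x (j , m.π a))) (x0 (m.π a))) ⟩
        m.ε a * 0ℤ
          ≡⟨ ℤ.*-zeroʳ (m.ε a) ⟩
        0ℤ ∎
  ; project = λ {y} (y∈ , y0) y⊑ →
      (λ j → m.project (y∈ (t.ι j)) (λ a ya≢0 → ≢-factorʳ (t.ε _) (m.ε a) (y⊑ _ ya≢0))) ,
      λ b → trans (t.project (λ j → y (j , m.ι b))
                     (λ j yj≢0 → ≢-factorˡ (t.ε j) _ (y⊑ _ yj≢0)))
                  (y0 (m.ι b)) }
  where
  module t = Truncation t
  module m = Minor m
  open ≡-Reasoning
  rotate : ∀ a b c → a * b * c ≡ b * (a * c)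
  rotate = solve-∀

regular-slices : {K : Space A} → Regular K → Regular (Slices n K)
regular-slices {K = K} reg x x∈ (j , a) xja≢0 k = reg _ (x∈ j) a xja≢0
  λ { (y , y∈ , sgn , ya≢0 , y⊑) → k
    ( (λ (j′ , a′) → δ j j′ * y a′)
    , (λ j′ → scale K (δ j j′) y∈)
    , (λ (j′ , a′) → *-isSign (bit⇒sign (δ-isBit j j′)) (sgn a′))
    , subst (λ d → d * y a ≢ 0ℤ) (sym (δ-refl j)) (*-≢0 {1ℤ} (λ ()) ya≢0)
    , λ (j′ , a′) y≢0 → subst (λ j → x (j , a′) ≢ 0ℤ)
        (δ-≢0 j j′ (≢-factorˡ (δ j j′) _ y≢0))
        (y⊑ a′ (≢-factorʳ (δ j j′) _ y≢0)) ) }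


find-≢0 : ∀ (f : Fin n → ℤ) → sum f ≢ 0ℤ → ∃ λ j → f j ≢ 0ℤ
find-≢0 {zero}  f Σ≢0 = contradiction refl Σ≢0
find-≢0 {suc n} f Σ≢0 with f zero ℤ.≟ 0ℤ
... | no f0≢0 = zero , f0≢0
... | yes f0≡0 with find-≢0 (f ∘ suc) (λ eq → Σ≢0 (cong₂ _+_ f0≡0 eq))
...   | j , fj≢0 = suc j , fj≢0

indicator : DecidableEquality A → A → A → ℤ
indicator _≟_ a b = if does (a ≟ b) then 1ℤ else 0ℤ

indicator-isBit : (_≟_ : DecidableEquality A) → ∀ a b → IsBit (indicator _≟_ a b)
indicator-isBit _≟_ a b with a ≟ b
... | yes _ = inj₂ refl
... | no  _ = inj₁ refl

indicator-refl : (_≟_ : DecidableEquality A) → ∀ a → indicator _≟_ a a ≡ 1ℤ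
indicator-refl _≟_ a with a ≟ a
... | yes _  = refl
... | no a≢a = contradiction refl a≢a

indicator-≢0 : (_≟_ : DecidableEquality A) → ∀ a b → indicator _≟_ a b ≢ 0ℤ → a ≡ b
indicator-≢0 _≟_ a b ≢0 with a ≟ b
... | yes a≡b = a≡b
... | no _    = contradiction refl ≢0

-- If the total at `a` is nonzero, a sign vector below the totals is lifted by placing each of its
-- entries in a single slice `p b` where `x` is nonzero. If it is zero, column `a` has a second
-- nonzero entry in some slice `i`, and the unit vector at `(j , a)` minus the one at `(i , a)` has
-- total zero.
regular-total : DecidableEquality A → {K : Space A} → Regular K → Regular (Total n K)
regular-total {A = A} {n = n} _≟_ {K} reg x x∈ (j , a) xja≢0 k with sum (λ j → x (j , a)) ℤ.≟ 0ℤ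
... | no za≢0 = reg z x∈ a za≢0 λ { (y , y∈ , sgn , ya≢0 , y⊑) → k
    ( (λ (i , b) → δ (p b) i * y b)
    , respects K (λ b → sym (sum-δ-* (p b) (y b))) y∈
    , (λ (i , b) → *-isSign (bit⇒sign (δ-isBit (p b) i)) (sgn b))
    , subst (λ i → δ i j * y a ≢ 0ℤ) (sym pa≡j)
        (subst (λ d → d * y a ≢ 0ℤ) (sym (δ-refl j)) (*-≢0 {1ℤ} (λ ()) ya≢0))
    , λ (i , b) y≢0 → subst (λ i → x (i , b) ≢ 0ℤ)
        (δ-≢0 (p b) i (≢-factorˡ (δ (p b) i) _ y≢0))
        (p-spec b (y⊑ b (≢-factorʳ (δ (p b) i) _ y≢0))) ) }
  where
  z : A → ℤ
  z b = sum λ i → x (i , b)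

  p : A → Fin n
  -- Slice `j` is preferred whenever `x` is nonzero there, so that `p a` is `j`. Where `z b`
  -- vanishes, so does the vector to be lifted, and `j` is only a default.
  p b with x (j , b) ℤ.≟ 0ℤ | z b ℤ.≟ 0ℤ
  ... | no _  | _       = j
  ... | yes _ | yes _   = j
  ... | yes _ | no zb≢0 = proj₁ (find-≢0 (λ i → x (i , b)) zb≢0)

  p-spec : ∀ b → z b ≢ 0ℤ → x (p b , b) ≢ 0ℤ
  p-spec b zb≢0 with x (j , b) ℤ.≟ 0ℤ | z b ℤ.≟ 0ℤ
  ... | no ≢0  | _        = ≢0
  ... | yes _  | yes zb≡0 = contradiction zb≡0 zb≢0
  ... | yes _  | no ≢0    = proj₂ (find-≢0 (λ i → x (i , b)) ≢0)

  pa≡j : p a ≡ j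
  pa≡j with x (j , a) ℤ.≟ 0ℤ | z a ℤ.≟ 0ℤ
  ... | no _     | _ = refl
  ... | yes xja≡0 | _ = contradiction xja≡0 xja≢0
... | yes za≡0 = xja≢0 (trans (sym (sum-concentrated j (λ i → x (i , a)) f⊑)) za≡0)
  where
  e : A → ℤ
  e = indicator _≟_ a

  module _ (i : Fin n) (xia≢0 : x (i , a) ≢ 0ℤ) (δji≡0 : δ j i ≡ 0ℤ) where
    i≢j : i ≢ j
    i≢j refl = contradiction (trans (sym δji≡0) (δ-refl j)) λ ()

    total-zero : ∀ b → sum (λ h → (δ j h - δ i h) * e b) ≡ 0ℤ
    total-zero b = begin
      sum (λ h → (δ j h - δ i h) * e b)
        ≡⟨ sum-cong-≗ (λ h → distrib (δ j h) (δ i h) (e b)) ⟩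
      sum (λ h → δ j h * e b + δ i h * - e b)
        ≡⟨ ∑-distrib-+ (λ h → δ j h * e b) (λ h → δ i h * - e b) ⟩
      sum (λ h → δ j h * e b) + sum (λ h → δ i h * - e b)
        ≡⟨ cong₂ _+_ (sum-δ-* j (e b)) (sum-δ-* i (- e b)) ⟩
      e b - e b
        ≡⟨ ℤ.+-inverseʳ (e b) ⟩
      0ℤ ∎
      where
      open ≡-Reasoning
      distrib : ∀ u v w → (u - v) * w ≡ u * w + v * - w
      distrib = solve-∀

    supported : (λ (h , b) → (δ j h - δ i h) * e b) ⊑ x
    supported (h , b) ≢0 with indicator-≢0 _≟_ a b (≢-factorʳ (δ j h - δ i h) (e b) ≢0)
    ... | refl with δ j h ℤ.≟ 0ℤ
    ...   | no  ≢0′ = subst (λ i → x (i , a) ≢ 0ℤ) (δ-≢0 j h ≢0′) xja≢0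
    ...   | yes ≡0  = subst (λ i → x (i , a) ≢ 0ℤ)
              (δ-≢0 i h λ ≡0′ → ≢0 (cong₂ (λ u v → (u - v) * e a) ≡0 ≡0′)) xia≢0

  f⊑ : (λ i → x (i , a)) ⊑ δ j
  f⊑ i xia≢0 δji≡0 = k
    ( (λ (h , b) → (δ j h - δ i h) * e b)
    , ∋-zero K x∈ (total-zero i xia≢0 δji≡0)
    , (λ (h , b) → *-isSign (bit-difference (δ-isBit j h) (δ-isBit i h))
                            (bit⇒sign (indicator-isBit _≟_ a b)))
    , (λ ≡0 → contradiction (trans (sym (cong₂ _*_
          (cong₂ _-_ (δ-refl j) (δ-≢ i j (i≢j i xia≢0 δji≡0))) (indicator-refl _≟_ a))) ≡0) λ ())
    , supported i xia≢0 δji≡0 )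

-- With two slices, each is the negative of the other, so they have the same support and a sign
-- vector `y` below one of them lifts to `y` and `- y`. With three slices this breaks down; see
-- `liftVector`.
regular-lawrence : {K : Space A} → Regular K → Regular (Lawrence 2 K)
regular-lawrence {A = A} {K = K} reg x (x∈ , x0) (j , a) xja≢0 k = reg _ (x∈ j) a xja≢0
  λ { (y , y∈ , sgn , ya≢0 , y⊑) → k
    ( (λ (i , b) → σ i * y b)
    , ((λ i → scale K (σ i) y∈) , (λ b → cancel (y b)))
    , (λ (i , b) → *-isSign (σ-isSign i) (sgn b))
    , *-≢0 (σ-≢0 j) ya≢0
    , λ (i , b) y≢0 xib≡0 → y⊑ b (≢-factorʳ (σ i) _ y≢0) (x≡0 i j b xib≡0) ) }
  where
  σ : Fin 2 → ℤ
  σ zero       = 1ℤ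
  σ (suc zero) = -1ℤ

  σ-isSign : ∀ i → IsSign (σ i)
  σ-isSign zero       = inj₂ (inj₁ refl)
  σ-isSign (suc zero) = inj₂ (inj₂ refl)

  σ-≢0 : ∀ i → σ i ≢ 0ℤ
  σ-≢0 zero       ()
  σ-≢0 (suc zero) ()

  cancel : ∀ u → 1ℤ * u + (-1ℤ * u + 0ℤ) ≡ 0ℤ
  cancel = solve-∀

  x≡0 : ∀ i j b → x (i , b) ≡ 0ℤ → x (j , b) ≡ 0ℤ
  x≡0 zero       zero       b eq = eq
  x≡0 (suc zero) (suc zero) b eq = eq
  x≡0 zero       (suc zero) b eq = begin
    x (suc zero , b)          ≡⟨ tidy _ ⟩
    0ℤ + (x (suc zero , b) + 0ℤ)      ≡⟨ cong (_+ (x (suc zero , b) + 0ℤ)) eq ⟨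
    x (zero , b) + (x (suc zero , b) + 0ℤ) ≡⟨ x0 b ⟩
    0ℤ ∎
    where
    open ≡-Reasoning
    tidy : ∀ u → u ≡ 0ℤ + (u + 0ℤ)
    tidy = solve-∀
  x≡0 (suc zero) zero       b eq = begin
    x (zero , b)               ≡⟨ ℤ.+-identityʳ _ ⟨
    x (zero , b) + 0ℤ          ≡⟨ cong (λ u → x (zero , b) + (u + 0ℤ)) eq ⟨
    x (zero , b) + (x (suc zero , b) + 0ℤ) ≡⟨ x0 b ⟩
    0ℤ ∎
    where open ≡-Reasoning

cons↔ : {d : Vec ℕ k} → (Fin n × Cell d) ↔ Cell (n ∷ d)
cons↔ = mk↔ₛ′ (uncurry _∷_) (λ { (j ∷ i) → j , i }) (λ { (j ∷ i) → refl }) (λ _ → refl)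

-- The kernel of D m n

-- A line of cells parallel to an axis: `here` marks the free vertex, and all other vertices are
-- fixed.
data Row : Vec ℕ k → Set where
  here  : {d : Vec ℕ k} → Cell d → Row (n ∷ d)
  there : {d : Vec ℕ k} → Fin n → Row d → Row (n ∷ d)

⟦_⟧ : {d : Vec ℕ k} → Row d → (Cell d → ℤ) → ℤ
⟦ here i ⟧ x    = sum λ j → x (j ∷ i)
⟦ there j r ⟧ x = ⟦ r ⟧ (x ∘ (j ∷_))

⟦⟧-cong : {d : Vec ℕ k} (r : Row d) {x y : Cell d → ℤ} → x ≗ y → ⟦ r ⟧ x ≡ ⟦ r ⟧ y
⟦⟧-cong (here {n = n} i) x≗y = sum-cong-≗ {n} (λ j → x≗y (j ∷ i))
⟦⟧-cong (there j r) x≗y = ⟦⟧-cong r (x≗y ∘ (j ∷_))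

⟦⟧-linear : {d : Vec ℕ k} (r : Row d) (a b : ℤ) (x y : Cell d → ℤ) →
            ⟦ r ⟧ (λ i → a * x i + b * y i) ≡ a * ⟦ r ⟧ x + b * ⟦ r ⟧ y
⟦⟧-linear (here {n = n} i) a b x y = sum-linear {n} a b (λ j → x (j ∷ i)) (λ j → y (j ∷ i))
⟦⟧-linear (there j r) a b x y      = ⟦⟧-linear r a b (x ∘ (j ∷_)) (y ∘ (j ∷_))

⟦⟧-scale : {d : Vec ℕ k} (r : Row d) (z : ℤ) (x : Cell d → ℤ) →
           ⟦ r ⟧ (λ i → z * x i) ≡ z * ⟦ r ⟧ x
⟦⟧-scale (here {n = n} i) z x = sym (*-distribˡ-sum {n} z (λ j → x (j ∷ i)))
⟦⟧-scale (there j r) z x      = ⟦⟧-scale r z (x ∘ (j ∷_))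

⟦⟧-zero : {d : Vec ℕ k} (r : Row d) {x : Cell d → ℤ} → (∀ i → x i ≡ 0ℤ) → ⟦ r ⟧ x ≡ 0ℤ
⟦⟧-zero (here i) x≡0    = sum-zero (λ j → x≡0 (j ∷ i))
⟦⟧-zero (there j r) x≡0 = ⟦⟧-zero r (x≡0 ∘ (j ∷_))

⟦⟧-sum : {d : Vec ℕ k} (r : Row d) (x : Cell d → Fin n → ℤ) →
         ⟦ r ⟧ (λ i → sum (x i)) ≡ sum (λ j → ⟦ r ⟧ (λ i → x i j))
⟦⟧-sum {n = n} (here {n = m} i) x = ∑-comm {m} {n} (λ j → x (j ∷ i))
⟦⟧-sum (there j r) x = ⟦⟧-sum r (x ∘ (j ∷_))

⟦⟧-comm : {d : Vec ℕ k} {e : Vec ℕ l} (r : Row d) (s : Row e) (x : Cell d → Cell e → ℤ) →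
          ⟦ r ⟧ (λ i → ⟦ s ⟧ (x i)) ≡ ⟦ s ⟧ (λ j → ⟦ r ⟧ (λ i → x i j))
⟦⟧-comm (here i) s x    = sym (⟦⟧-sum s (λ j h → x (h ∷ i) j))
⟦⟧-comm (there j r) s x = ⟦⟧-comm r s (x ∘ (j ∷_))

-- The kernel belonging to the boundary of a simplex, whose facets omit one vertex each.
Ends : (d : Vec ℕ k) → Space (Cell d)
Ends d = record
  { _∋_      = λ x → ∀ r → ⟦ r ⟧ x ≡ 0ℤ
  ; respects = λ x≗y x∈ r → trans (⟦⟧-cong r (sym ∘ x≗y)) (x∈ r)
  ; linear   = λ a b {x} {y} x∈ y∈ r →
      trans (⟦⟧-linear r a b x y) (linear-zero a b (x∈ r) (y∈ r)) }

-- The boundary of a simplex is an iterated Lawrence lifting, so the minors of `Lawrence` can be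
-- used here vertex by vertex.
ends-∷ : {d : Vec ℕ k} → Ends (n ∷ d) ≐ reindex cons↔ (Lawrence n (Ends d))
ends-∷ = equal
  (λ x∈ → (λ j r → x∈ (there j r)) , λ i → x∈ (here i))
  (λ { (x∈ , x0) (here i) → x0 i ; (x∈ , x0) (there j r) → x∈ j r })

ends-cons : {d : Vec ℕ k} {d′ : Vec ℕ k′} → Truncation n n′ →
            Minor (Ends d) (Ends d′) → Minor (Ends (n ∷ d)) (Ends (n′ ∷ d′))
ends-cons t m = minor-trans (≐⇒minor ends-∷) (minor-trans (reindex-minor cons↔)
  (minor-trans (lawrence-cong t m) (minor-trans (minor-reindex cons↔) (≐⇒minor (≐-sym ends-∷)))))

ends-tail : {d : Vec ℕ k} → 2 ≤ n → Minor (Ends (n ∷ d)) (Ends d)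
ends-tail (s≤s (s≤s z≤n)) =
  minor-trans (≐⇒minor ends-∷) (minor-trans (reindex-minor cons↔) lawrence-minor)

truncate : suc n′ ≤ n → Truncation n (suc n′)
truncate = truncation ∘ ℕ.≤⇒≤′

ends-[] : {d : Vec ℕ k} → (∀ v → 2 ≤ lookup d v) → Minor (Ends d) (Ends [])
ends-[] {d = []}    _   = ≐⇒minor ≐-refl
ends-[] {d = n ∷ d} d≥2 = minor-trans (ends-tail (d≥2 zero)) (ends-[] (d≥2 ∘ suc))

ends-vertex : {d : Vec ℕ k} → (∀ v → 2 ≤ lookup d v) → ∀ v → suc n ≤ lookup d v →
              Minor (Ends d) (Ends (suc n ∷ []))
ends-vertex {d = _ ∷ _} d≥2 zero    n<dv = ends-cons (truncate n<dv) (ends-[] (d≥2 ∘ suc))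
ends-vertex {d = _ ∷ _} d≥2 (suc v) n<dv =
  minor-trans (ends-tail (d≥2 zero)) (ends-vertex (d≥2 ∘ suc) v n<dv)

ends-swap : Minor (Ends (n ∷ n′ ∷ [])) (Ends (n′ ∷ n ∷ []))
ends-swap {n} {n′} = record
  { ι = flip ; π = flip ; ε = λ _ → 1ℤ
  ; π∘ι = λ { (_ ∷ _ ∷ []) → refl } ; ε∘ι = λ _ → refl
  ; extend = λ {x} x∈ → scale (Ends (n ∷ n′ ∷ [])) 1ℤ {x ∘ flip}
      λ { (here (j ∷ [])) → x∈ (there j (here [])) ; (there i (here [])) → x∈ (here (i ∷ [])) }
  ; project = λ y∈ _ →
      λ { (here (j ∷ [])) → y∈ (there j (here [])) ; (there i (here [])) → y∈ (here (i ∷ [])) } }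
  where
  flip : ∀ {n n′} → Cell (n ∷ n′ ∷ []) → Cell (n′ ∷ n ∷ [])
  flip (i ∷ j ∷ []) = j ∷ i ∷ []

-- The chosen vertex always ends up in front, so that one irregular table serves every position. It
-- is used with `suc n` equal to 2 and to 3.
ends-pair : {d : Vec ℕ (suc (suc k))} → (∀ v → 2 ≤ lookup d v) → ∀ v → suc n ≤ lookup d v →
            Minor (Ends d) (Ends (suc n ∷ 2 ∷ []))
ends-pair {d = _ ∷ _} d≥2 zero    n<dv =
  ends-cons (truncate n<dv) (ends-vertex (d≥2 ∘ suc) zero (d≥2 (suc zero)))
ends-pair {d = _ ∷ _} d≥2 (suc v) n<dv =
  minor-trans (ends-cons (truncate (d≥2 zero)) (ends-vertex (d≥2 ∘ suc) v n<dv)) ends-swap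

-- The facets of D m n omit one vertex of each block, so its kernel is the space
-- of vectors whose sums over any one vertex of each block vanish.
Cuts : (d : Vec ℕ k) (e : Vec ℕ l) → Space (Cell d × Cell e)
Cuts d e = record
  { _∋_      = λ x → ∀ r s → ⟦ r ⟧ (λ i → ⟦ s ⟧ (λ j → x (i , j))) ≡ 0ℤ
  ; respects = λ x≗y x∈ r s →
      trans (⟦⟧-cong r λ i → ⟦⟧-cong s λ j → sym (x≗y (i , j))) (x∈ r s)
  ; linear   = λ a b {x} {y} x∈ y∈ r s → trans
      (⟦⟧-cong r λ i → ⟦⟧-linear s a b (λ j → x (i , j)) (λ j → y (i , j)))
      (trans (⟦⟧-linear r a b _ _) (linear-zero a b (x∈ r s) (y∈ r s))) }

cuts-swap : {d : Vec ℕ k} {e : Vec ℕ l} → Minor (Cuts d e) (Cuts e d)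
cuts-swap {d = d} {e} = record
  { ι = swap ; π = swap ; ε = λ _ → 1ℤ ; π∘ι = λ _ → refl ; ε∘ι = λ _ → refl
  ; extend  = λ {x} x∈ → scale (Cuts d e) 1ℤ {x ∘ swap}
      λ r s → trans (⟦⟧-comm r s (λ i j → x (j , i))) (x∈ s r)
  ; project = λ {y} y∈ _ r s → trans (⟦⟧-comm r s (λ j i → y (i , j))) (y∈ s r) }

-- For a fixed row `s` of the second block, summing over `s` leaves a vector of `Ends d`, to which
-- `m` applies.
cuts-left : {d : Vec ℕ k} {d′ : Vec ℕ k′} {e : Vec ℕ l} →
            Minor (Ends d) (Ends d′) → Minor (Cuts d e) (Cuts d′ e)
cuts-left {e = e} m = record
  { ι = λ (i , j) → m.ι i , j ; π = λ (i , j) → m.π i , j ; ε = λ (i , _) → m.ε i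
  ; π∘ι = λ (i , j) → cong (_, j) (m.π∘ι i) ; ε∘ι = λ (i , _) → m.ε∘ι i
  ; extend = λ {x} x∈ r s → trans
      (⟦⟧-cong r (λ i → ⟦⟧-scale s (m.ε i) (λ j → x (m.π i , j))))
      (m.extend (λ r → x∈ r s) r)
  ; project = λ {y} y∈ y⊑ r s → m.project {λ i → ⟦ s ⟧ (λ j → y (i , j))} (λ r → y∈ r s)
      (λ i ≢0 εi≡0 → ≢0 (⟦⟧-zero s (λ j → ⊑-zero {x = λ (i , _) → m.ε i} y⊑ εi≡0))) r }
  where module m = Minor m

cuts-minor : {d : Vec ℕ k} {d′ : Vec ℕ k′} {e : Vec ℕ l} {e′ : Vec ℕ n} →
             Minor (Ends d) (Ends d′) → Minor (Ends e) (Ends e′) → Minor (Cuts d e) (Cuts d′ e′)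
cuts-minor p q =
  minor-trans (cuts-left p) (minor-trans cuts-swap (minor-trans (cuts-left q) cuts-swap))

-- Unimodularity of the binary cut space

Binary : Vec ℕ k → Set
Binary = All (_≡ 2)

-- The parity sign: -1 to the number of nonzero coordinates.
χ : {d : Vec ℕ k} → Cell d → ℤ
χ []          = 1ℤ
χ (zero ∷ i)  = χ i
χ (suc _ ∷ i) = - χ i

neg-isSign : ∀ {z} → IsSign z → IsSign (- z)
neg-isSign (inj₁ refl)        = inj₁ refl
neg-isSign (inj₂ (inj₁ refl)) = inj₂ (inj₂ refl)
neg-isSign (inj₂ (inj₂ refl)) = inj₂ (inj₁ refl)

χ-isSign : {d : Vec ℕ k} (i : Cell d) → IsSign (χ i)
χ-isSign []          = inj₂ (inj₁ refl)
χ-isSign (zero ∷ i)  = χ-isSign i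
χ-isSign (suc _ ∷ i) = neg-isSign (χ-isSign i)

χ-≢0 : {d : Vec ℕ k} (i : Cell d) → χ i ≢ 0ℤ
χ-≢0 []          ()
χ-≢0 (zero ∷ i)  = χ-≢0 i
χ-≢0 (suc _ ∷ i) = χ-≢0 i ∘ ℤ.neg-injective

χ∈ends : {d : Vec ℕ k} → Binary d → Ends d ∋ χ
χ∈ends (refl ∷ bin) (here i)             = cancel (χ i)
  where
  cancel : ∀ u → u + (- u + 0ℤ) ≡ 0ℤ
  cancel = solve-∀
χ∈ends (refl ∷ bin) (there zero r)       = χ∈ends bin r
χ∈ends (refl ∷ bin) (there (suc zero) r) =
  respects (Ends _) (λ i → ℤ.-1*i≡-i (χ i)) (scale (Ends _) -1ℤ (χ∈ends bin)) r

-- For binary d the space Ends d is spanned by χ.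
ends-constant : {d : Vec ℕ k} → Binary d → ∀ {x} → Ends d ∋ x →
                ∀ i i₀ → χ i * x i ≡ χ i₀ * x i₀
ends-constant []           x∈ []      []        = refl
ends-constant (refl ∷ bin) {x} x∈ (j ∷ i) (j₀ ∷ i₀) = trans (along j) (across j j₀)
  where
  along : ∀ j → χ (j ∷ i) * x (j ∷ i) ≡ χ (j ∷ i₀) * x (j ∷ i₀)
  along zero       = ends-constant bin (λ r → x∈ (there zero r)) i i₀
  along (suc zero) = begin
    - χ i * x (1F ∷ i)      ≡⟨ ℤ.neg-distribˡ-* (χ i) _ ⟨
    - (χ i * x (1F ∷ i))    ≡⟨ cong -_ (ends-constant bin (λ r → x∈ (there 1F r)) i i₀) ⟩
    - (χ i₀ * x (1F ∷ i₀))  ≡⟨ ℤ.neg-distribˡ-* (χ i₀) _ ⟩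
    - χ i₀ * x (1F ∷ i₀)    ∎
    where open ≡-Reasoning

  opposite : χ i₀ * x (0F ∷ i₀) ≡ - χ i₀ * x (1F ∷ i₀)
  opposite = begin
    χ i₀ * x (0F ∷ i₀)
      ≡⟨ tidy (χ i₀) (x (0F ∷ i₀)) (x (1F ∷ i₀)) ⟩
    χ i₀ * (x (0F ∷ i₀) + (x (1F ∷ i₀) + 0ℤ)) + - χ i₀ * x (1F ∷ i₀)
      ≡⟨ cong (λ z → χ i₀ * z + - χ i₀ * x (1F ∷ i₀)) (x∈ (here i₀)) ⟩
    χ i₀ * 0ℤ + - χ i₀ * x (1F ∷ i₀)
      ≡⟨ cong (_+ - χ i₀ * x (1F ∷ i₀)) (ℤ.*-zeroʳ (χ i₀)) ⟩
    0ℤ + - χ i₀ * x (1F ∷ i₀)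
      ≡⟨ ℤ.+-identityˡ _ ⟩
    - χ i₀ * x (1F ∷ i₀) ∎
    where
    open ≡-Reasoning
    tidy : ∀ c u v → c * u ≡ c * (u + (v + 0ℤ)) + - c * v
    tidy = solve-∀

  across : ∀ j j₀ → χ (j ∷ i₀) * x (j ∷ i₀) ≡ χ (j₀ ∷ i₀) * x (j₀ ∷ i₀)
  across zero       zero       = refl
  across zero       (suc zero) = opposite
  across (suc zero) zero       = sym opposite
  across (suc zero) (suc zero) = refl

-- The term with `φ` is killed by the row `r` and the term with `γ` by the row `s`, since each of
-- them depends on the other block only through `χ`.
potential∈cuts : {d : Vec ℕ k} {e : Vec ℕ l} → Binary d → Binary e →
                 ∀ (φ : Cell e → ℤ) (γ : Cell d → ℤ) →
                 Cuts d e ∋ λ (i , j) → χ i * (χ j * (φ j - γ i))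
potential∈cuts bin bin′ φ γ r s = begin
  ⟦ r ⟧ (λ i → ⟦ s ⟧ (λ j → χ i * (χ j * (φ j - γ i))))
    ≡⟨ ⟦⟧-cong r (λ i → trans (⟦⟧-cong s (λ j → distrib (χ i) (χ j) (φ j) (γ i)))
         (⟦⟧-linear s (χ i) (- (χ i * γ i)) (λ j → χ j * φ j) χ)) ⟩
  ⟦ r ⟧ (λ i → χ i * c + - (χ i * γ i) * ⟦ s ⟧ χ)
    ≡⟨ ⟦⟧-cong r (λ i → cong (λ z → χ i * c + - (χ i * γ i) * z) (χ∈ends bin′ s)) ⟩
  ⟦ r ⟧ (λ i → χ i * c + - (χ i * γ i) * 0ℤ)
    ≡⟨ ⟦⟧-cong r (λ i → tidy (χ i) c (- (χ i * γ i))) ⟩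
  ⟦ r ⟧ (λ i → c * χ i)
    ≡⟨ ⟦⟧-scale r c χ ⟩
  c * ⟦ r ⟧ χ
    ≡⟨ cong (c *_) (χ∈ends bin r) ⟩
  c * 0ℤ
    ≡⟨ ℤ.*-zeroʳ c ⟩
  0ℤ ∎
  where
  open ≡-Reasoning
  c : ℤ
  c = ⟦ s ⟧ (λ j → χ j * φ j)
  distrib : ∀ p q f g → p * (q * (f - g)) ≡ p * (q * f) + - (p * g) * q
  distrib = solve-∀
  tidy : ∀ p q z → p * q + z * 0ℤ ≡ q * p
  tidy = solve-∀

-- Applying `ends-constant` in both blocks shows that all mixed second differences of `u` vanish, so
-- `u` splits into a function of `j` minus a function of `i`. The splitting is normalised so that
-- the second function is 0 at `i₀`, the value at which the threshold function vanishes.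
cuts-potential : {d : Vec ℕ k} {e : Vec ℕ l} → Binary d → Binary e → ∀ {x} → Cuts d e ∋ x →
  let u = λ i j → χ i * (χ j * x (i , j)) in
  ∀ i₀ j₀ i j → u i j ≡ u i₀ j - (u i₀ j₀ - u i j₀)
cuts-potential {e = e} bin bin′ {x} x∈ i₀ j₀ i j = begin
  χ i * (χ j * x (i , j))
    ≡⟨ expand (χ i) (χ i₀) (χ j) (x (i , j)) (x (i₀ , j)) ⟩
  χ j * f j + χ i₀ * (χ j * x (i₀ , j))
    ≡⟨ cong (_+ χ i₀ * (χ j * x (i₀ , j))) (ends-constant bin′ f∈ j j₀) ⟩
  χ j₀ * f j₀ + χ i₀ * (χ j * x (i₀ , j))
    ≡⟨ collect (χ i) (χ i₀) (χ j) (χ j₀) (x (i , j₀)) (x (i₀ , j₀)) (x (i₀ , j)) ⟩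
  χ i₀ * (χ j * x (i₀ , j)) - (χ i₀ * (χ j₀ * x (i₀ , j₀)) - χ i * (χ j₀ * x (i , j₀))) ∎
  where
  open ≡-Reasoning
  f : Cell e → ℤ
  f j = χ i * x (i , j) + - χ i₀ * x (i₀ , j)
  f∈ : Ends e ∋ f
  f∈ s = begin
    ⟦ s ⟧ f
      ≡⟨ ⟦⟧-linear s (χ i) (- χ i₀) (λ j → x (i , j)) (λ j → x (i₀ , j)) ⟩
    χ i * ⟦ s ⟧ (λ j → x (i , j)) + - χ i₀ * ⟦ s ⟧ (λ j → x (i₀ , j))
      ≡⟨ cong (_+ - χ i₀ * ⟦ s ⟧ (λ j → x (i₀ , j)))
           (ends-constant bin {λ i → ⟦ s ⟧ (λ j → x (i , j))} (λ r → x∈ r s) i i₀) ⟩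
    χ i₀ * ⟦ s ⟧ (λ j → x (i₀ , j)) + - χ i₀ * ⟦ s ⟧ (λ j → x (i₀ , j))
      ≡⟨ cancel (χ i₀) _ ⟩
    0ℤ ∎
    where
    cancel : ∀ p q → p * q + - p * q ≡ 0ℤ
    cancel = solve-∀
  expand : ∀ p p₀ q y y₀ → p * (q * y) ≡ q * (p * y + - p₀ * y₀) + p₀ * (q * y₀)
  expand = solve-∀
  collect : ∀ p p₀ q q₀ y y₀ z →
            q₀ * (p * y + - p₀ * y₀) + p₀ * (q * z) ≡ p₀ * (q * z) - (p₀ * (q₀ * y₀) - p * (q₀ * y))
  collect = solve-∀

-- The instances of `σ` are indicators of a half-line that contains `z` but not 0. Equal potentials
-- remain equal under any `σ`, which is why the support can only shrink.
record Threshold (z : ℤ) : Set where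
  field
    σ      : ℤ → ℤ
    σ-difference : ∀ u v → IsSign (σ u - σ v)
    σ0     : σ 0ℤ ≡ 0ℤ
    σz     : σ z ≢ 0ℤ

positivePart : ℤ → ℤ
positivePart (ℤ.+ suc _) = 1ℤ
positivePart _           = 0ℤ

negativePart : ℤ → ℤ
negativePart -[1+ _ ] = 1ℤ
negativePart _        = 0ℤ

threshold : ∀ z → z ≢ 0ℤ → Threshold z
threshold (ℤ.+ zero)  z≢0 = contradiction refl z≢0
threshold (ℤ.+ suc n) _   = record
  { σ = positivePart ; σ-difference = λ u v → bit-difference (bit u) (bit v)
  ; σ0 = refl ; σz = λ () }
  where
  bit : ∀ u → IsBit (positivePart u)
  bit (ℤ.+ zero)  = inj₁ refl
  bit (ℤ.+ suc _) = inj₂ refl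
  bit -[1+ _ ]    = inj₁ refl
threshold -[1+ n ]    _   = record
  { σ = negativePart ; σ-difference = λ u v → bit-difference (bit u) (bit v)
  ; σ0 = refl ; σz = λ () }
  where
  bit : ∀ u → IsBit (negativePart u)
  bit (ℤ.+ _)  = inj₁ refl
  bit -[1+ _ ] = inj₂ refl

-- Up to the signs χ, a vector of Cuts d e is a coboundary φ j − γ i on a
-- complete bipartite graph; cutting φ and γ at a threshold yields a sign
-- vector with smaller support.
regular-cuts : {d : Vec ℕ k} {e : Vec ℕ l} → Binary d → Binary e → Regular (Cuts d e)
regular-cuts bin bin′ x x∈ (i₀ , j₀) xc≢0 k = k
  ( (λ (i , j) → χ i * (χ j * (σ (φ j) - σ (γ i))))
  , potential∈cuts bin bin′ (σ ∘ φ) (σ ∘ γ)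
  , (λ (i , j) → *-isSign (χ-isSign i) (*-isSign (χ-isSign j) (σ-difference (φ j) (γ i))))
  , *-≢0 (χ-≢0 i₀) (*-≢0 (χ-≢0 j₀) λ eq → σz (begin
      σ (u i₀ j₀)                ≡⟨ ℤ.+-identityʳ _ ⟨
      σ (u i₀ j₀) - 0ℤ           ≡⟨ cong (λ z → σ (u i₀ j₀) - z) σ0 ⟨
      σ (u i₀ j₀) - σ 0ℤ         ≡⟨ cong (λ z → σ (u i₀ j₀) - σ z) (ℤ.+-inverseʳ (u i₀ j₀)) ⟨
      σ (φ j₀) - σ (γ i₀)        ≡⟨ eq ⟩
      0ℤ                         ∎))
  , λ (i , j) y≢0 xij≡0 → ≢-factorʳ (χ j) _ (≢-factorʳ (χ i) _ y≢0)
      (trans (cong (λ z → σ z - σ (γ i)) (F≡γ xij≡0)) (ℤ.+-inverseʳ (σ (γ i)))) )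
  where
  open ≡-Reasoning
  u : _ → _ → ℤ
  u i j = χ i * (χ j * x (i , j))
  φ : _ → ℤ
  φ j = u i₀ j
  γ : _ → ℤ
  γ i = u i₀ j₀ - u i j₀
  open Threshold (threshold (u i₀ j₀) (*-≢0 (χ-≢0 i₀) (*-≢0 (χ-≢0 j₀) xc≢0)))
  F≡γ : ∀ {i j} → x (i , j) ≡ 0ℤ → φ j ≡ γ i
  F≡γ {i} {j} xij≡0 = ℤ.i-j≡0⇒i≡j (φ j) (γ i) (begin
    φ j - γ i                ≡⟨ cuts-potential bin bin′ x∈ i₀ j₀ i j ⟨
    χ i * (χ j * x (i , j))  ≡⟨ cong (λ z → χ i * (χ j * z)) xij≡0 ⟩
    χ i * (χ j * 0ℤ)         ≡⟨ cong (χ i *_) (ℤ.*-zeroʳ (χ j)) ⟩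
    χ i * 0ℤ                 ≡⟨ ℤ.*-zeroʳ (χ i) ⟩
    0ℤ                       ∎)

-- The two irregular spaces

-2ℤ 2ℤ : ℤ
-2ℤ = -[1+ 1 ]
2ℤ = ℤ.+ 2

-- A sign vector y with y ⊑ x is compared with x by means of w = y − y(s) x.
irregular : (K : Space A) {x : A → ℤ} → K ∋ x → ∀ {s f} → x s ≡ 1ℤ → x f ≡ -2ℤ →
            (∀ w → K ∋ w → w ⊑ x → w s ≡ 0ℤ → w f ≡ 0ℤ) → ¬ Regular K
irregular {A = A} K {x} x∈ {s} {f} xs≡1 xf≡-2 forced reg =
  reg x x∈ s (λ xs≡0 → contradiction (trans (sym xs≡1) xs≡0) λ ())
    λ { (y , y∈ , sgn , ys≢0 , y⊑x) → let w = λ c → 1ℤ * y c + - y s * x c in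
      clash (y s) (y f) (sgn s) (sgn f) ys≢0
        (subst (λ z → 1ℤ * y f + - y s * z ≡ 0ℤ) xf≡-2
          (forced w (linear K 1ℤ (- y s) y∈ x∈)
            (λ c wc≢0 xc≡0 → wc≢0 (linear-zero 1ℤ (- y s) (⊑-zero y⊑x xc≡0) xc≡0))
            (trans (cong (λ z → 1ℤ * y s + - y s * z) xs≡1) (cancel (y s))))) }
  where
  cancel : ∀ u → 1ℤ * u + - u * 1ℤ ≡ 0ℤ
  cancel = solve-∀
  clash : ∀ u v → IsSign u → IsSign v → u ≢ 0ℤ → 1ℤ * v + - u * -2ℤ ≢ 0ℤ
  clash u v (inj₁ u≡0) _ u≢0 _ = u≢0 u≡0
  clash _ _ (inj₂ (inj₁ refl)) (inj₁ refl)        _ ()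
  clash _ _ (inj₂ (inj₁ refl)) (inj₂ (inj₁ refl)) _ ()
  clash _ _ (inj₂ (inj₁ refl)) (inj₂ (inj₂ refl)) _ ()
  clash _ _ (inj₂ (inj₂ refl)) (inj₁ refl)        _ ()
  clash _ _ (inj₂ (inj₂ refl)) (inj₂ (inj₁ refl)) _ ()
  clash _ _ (inj₂ (inj₂ refl)) (inj₂ (inj₂ refl)) _ ()

-- The propagation step of the two forcing arguments: an equation with a single entry not yet known
-- to vanish makes that entry vanish.
sum-forced : (f : Fin n → ℤ) → sum f ≡ 0ℤ → ∀ a → (∀ b → b ≡ a ⊎ f b ≡ 0ℤ) → f a ≡ 0ℤ
sum-forced f Σf≡0 a others = trans (sym (sum-concentrated a f f⊑)) Σf≡0
  where
  f⊑ : f ⊑ δ a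
  f⊑ b fb≢0 with others b
  ... | inj₁ refl = λ δ≡0 → contradiction (trans (sym (δ-refl b)) δ≡0) λ ()
  ... | inj₂ fb≡0 = contradiction fb≡0 fb≢0

sums-forced : (f : Fin n → Fin n′ → ℤ) → sum (λ a → sum (f a)) ≡ 0ℤ →
              ∀ a b → (∀ a′ b′ → (a′ ≡ a × b′ ≡ b) ⊎ f a′ b′ ≡ 0ℤ) → f a b ≡ 0ℤ
sums-forced f ΣΣf≡0 a b others = sum-forced (f a)
  (sum-forced (λ a′ → sum (f a′)) ΣΣf≡0 a column) b row
  where
  column : ∀ a′ → a′ ≡ a ⊎ sum (f a′) ≡ 0ℤ
  column a′ with a′ Fin.≟ a
  ... | yes a′≡a = inj₁ a′≡a
  ... | no a′≢a  = inj₂ (sum-zero λ b′ →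
          [ (λ (a′≡a , _) → contradiction a′≡a a′≢a) , id ]′ (others a′ b′))
  row : ∀ b′ → b′ ≡ b ⊎ f a b′ ≡ 0ℤ
  row b′ with others a b′
  ... | inj₁ (_ , b′≡b) = inj₁ b′≡b
  ... | inj₂ fab′≡0     = inj₂ fab′≡0

-- Entries indexed by the two vertices of the first block, then of the second;
-- this vector and the next were found by a computer search.
ternaryTable : Vec (Vec (Vec (Vec ℤ 2) 2) 2) 3
ternaryTable =
  ( ((0ℤ ∷ -1ℤ ∷ []) ∷ (1ℤ ∷ 0ℤ ∷ []) ∷ [])
  ∷ ((1ℤ ∷ 0ℤ ∷ []) ∷ (-2ℤ ∷ 1ℤ ∷ []) ∷ []) ∷ [])
  ∷ ( ((1ℤ ∷ 0ℤ ∷ []) ∷ (-1ℤ ∷ 0ℤ ∷ []) ∷ [])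
    ∷ ((0ℤ ∷ -1ℤ ∷ []) ∷ (0ℤ ∷ 1ℤ ∷ []) ∷ []) ∷ [])
  ∷ ( ((-1ℤ ∷ 1ℤ ∷ []) ∷ (0ℤ ∷ 0ℤ ∷ []) ∷ [])
    ∷ ((0ℤ ∷ 0ℤ ∷ []) ∷ (1ℤ ∷ -1ℤ ∷ []) ∷ []) ∷ [])
  ∷ []

ternaryVector : Cell (3 ∷ 2 ∷ []) × Cell (2 ∷ 2 ∷ []) → ℤ
ternaryVector ((a ∷ b ∷ []) , (c ∷ e ∷ [])) =
  lookup (lookup (lookup (lookup ternaryTable a) b) c) e

ternaryVector∈cuts : Cuts (3 ∷ 2 ∷ []) (2 ∷ 2 ∷ []) ∋ ternaryVector
ternaryVector∈cuts (here (b ∷ [])) (here (e ∷ [])) =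
  toWitness {a? = Fin.all? λ b → Fin.all? λ e →
    ⟦ here (b ∷ []) ⟧ (λ i → ⟦ here (e ∷ []) ⟧ (λ j → ternaryVector (i , j))) ℤ.≟ 0ℤ} _ b e
ternaryVector∈cuts (here (b ∷ [])) (there c (here [])) =
  toWitness {a? = Fin.all? λ b → Fin.all? λ c →
    ⟦ here (b ∷ []) ⟧ (λ i → ⟦ there c (here []) ⟧ (λ j → ternaryVector (i , j))) ℤ.≟ 0ℤ} _ b c
ternaryVector∈cuts (there a (here [])) (here (e ∷ [])) =
  toWitness {a? = Fin.all? λ a → Fin.all? λ e →
    ⟦ there a (here []) ⟧ (λ i → ⟦ here (e ∷ []) ⟧ (λ j → ternaryVector (i , j))) ℤ.≟ 0ℤ} _ a e
ternaryVector∈cuts (there a (here [])) (there c (here [])) =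
  toWitness {a? = Fin.all? λ a → Fin.all? λ c →
    ⟦ there a (here []) ⟧ (λ i → ⟦ there c (here []) ⟧ (λ j → ternaryVector (i , j))) ℤ.≟ 0ℤ} _ a c

-- Zeros spread from the given entry along equations with one unknown each. Two chains, through
-- `w1≡0` and `w5≡0` and through `w3≡0` and `w4≡0`, meet in the equation for `w6≡0`, where the
-- entries of `ternaryVector` are 1, 1 and -2.
ternaryVector-forced : ∀ w → Cuts (3 ∷ 2 ∷ []) (2 ∷ 2 ∷ []) ∋ w → w ⊑ ternaryVector →
  w ((1F ∷ 1F ∷ []) , (1F ∷ 1F ∷ [])) ≡ 0ℤ → w ((0F ∷ 1F ∷ []) , (1F ∷ 0F ∷ [])) ≡ 0ℤ
ternaryVector-forced w w∈ w⊑ w≡0 = w6≡0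
  where
  vanish : ∀ c → ternaryVector c ≡ 0ℤ → w c ≡ 0ℤ
  vanish c = ⊑-zero w⊑ {c}
  w1≡0 : w ((1F ∷ 1F ∷ []) , (0F ∷ 1F ∷ [])) ≡ 0ℤ
  w1≡0 = sums-forced (λ a b → w ((1F ∷ a ∷ []) , (b ∷ 1F ∷ [])))
    (w∈ (there 1F (here [])) (here (1F ∷ []))) 1F 0F λ
    { 0F 0F → inj₂ (vanish ((1F ∷ 0F ∷ []) , (0F ∷ 1F ∷ [])) refl)
    ; 0F 1F → inj₂ (vanish ((1F ∷ 0F ∷ []) , (1F ∷ 1F ∷ [])) refl)
    ; 1F 0F → inj₁ (refl , refl)
    ; 1F 1F → inj₂ w≡0
    }
  w2≡0 : w ((1F ∷ 0F ∷ []) , (0F ∷ 0F ∷ [])) ≡ 0ℤ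
  w2≡0 = sums-forced (λ a b → w ((1F ∷ a ∷ []) , (0F ∷ b ∷ [])))
    (w∈ (there 1F (here [])) (there 0F (here []))) 0F 0F λ
    { 0F 0F → inj₁ (refl , refl)
    ; 0F 1F → inj₂ (vanish ((1F ∷ 0F ∷ []) , (0F ∷ 1F ∷ [])) refl)
    ; 1F 0F → inj₂ (vanish ((1F ∷ 1F ∷ []) , (0F ∷ 0F ∷ [])) refl)
    ; 1F 1F → inj₂ w1≡0
    }
  w3≡0 : w ((1F ∷ 0F ∷ []) , (1F ∷ 0F ∷ [])) ≡ 0ℤ
  w3≡0 = sums-forced (λ a b → w ((1F ∷ a ∷ []) , (1F ∷ b ∷ [])))
    (w∈ (there 1F (here [])) (there 1F (here []))) 0F 0F λ
    { 0F 0F → inj₁ (refl , refl)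
    ; 0F 1F → inj₂ (vanish ((1F ∷ 0F ∷ []) , (1F ∷ 1F ∷ [])) refl)
    ; 1F 0F → inj₂ (vanish ((1F ∷ 1F ∷ []) , (1F ∷ 0F ∷ [])) refl)
    ; 1F 1F → inj₂ w≡0
    }
  w4≡0 : w ((0F ∷ 0F ∷ []) , (1F ∷ 0F ∷ [])) ≡ 0ℤ
  w4≡0 = sums-forced (λ a b → w ((a ∷ 0F ∷ []) , (1F ∷ b ∷ [])))
    (w∈ (here (0F ∷ [])) (there 1F (here []))) 0F 0F λ
    { 0F 0F → inj₁ (refl , refl)
    ; 0F 1F → inj₂ (vanish ((0F ∷ 0F ∷ []) , (1F ∷ 1F ∷ [])) refl)
    ; 1F 0F → inj₂ w3≡0
    ; 1F 1F → inj₂ (vanish ((1F ∷ 0F ∷ []) , (1F ∷ 1F ∷ [])) refl)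
    ; 2F 0F → inj₂ (vanish ((2F ∷ 0F ∷ []) , (1F ∷ 0F ∷ [])) refl)
    ; 2F 1F → inj₂ (vanish ((2F ∷ 0F ∷ []) , (1F ∷ 1F ∷ [])) refl)
    }
  w5≡0 : w ((0F ∷ 1F ∷ []) , (0F ∷ 0F ∷ [])) ≡ 0ℤ
  w5≡0 = sums-forced (λ a b → w ((a ∷ 1F ∷ []) , (0F ∷ b ∷ [])))
    (w∈ (here (1F ∷ [])) (there 0F (here []))) 0F 0F λ
    { 0F 0F → inj₁ (refl , refl)
    ; 0F 1F → inj₂ (vanish ((0F ∷ 1F ∷ []) , (0F ∷ 1F ∷ [])) refl)
    ; 1F 0F → inj₂ (vanish ((1F ∷ 1F ∷ []) , (0F ∷ 0F ∷ [])) refl)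
    ; 1F 1F → inj₂ w1≡0
    ; 2F 0F → inj₂ (vanish ((2F ∷ 1F ∷ []) , (0F ∷ 0F ∷ [])) refl)
    ; 2F 1F → inj₂ (vanish ((2F ∷ 1F ∷ []) , (0F ∷ 1F ∷ [])) refl)
    }
  w6≡0 : w ((0F ∷ 1F ∷ []) , (1F ∷ 0F ∷ [])) ≡ 0ℤ
  w6≡0 = sums-forced (λ a b → w ((0F ∷ a ∷ []) , (b ∷ 0F ∷ [])))
    (w∈ (there 0F (here [])) (here (0F ∷ []))) 1F 1F λ
    { 0F 0F → inj₂ (vanish ((0F ∷ 0F ∷ []) , (0F ∷ 0F ∷ [])) refl)
    ; 0F 1F → inj₂ w4≡0
    ; 1F 0F → inj₂ w5≡0
    ; 1F 1F → inj₁ (refl , refl)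
    }

ternary-irregular : ¬ Regular (Cuts (3 ∷ 2 ∷ []) (2 ∷ 2 ∷ []))
ternary-irregular = irregular (Cuts _ _) ternaryVector∈cuts refl refl ternaryVector-forced

-- The potentials of the three slices of a vector of Lawrence 3 (Cuts d e).
liftF liftG : Vec (Vec (Vec ℤ 2) 2) 3
liftF = ((0ℤ ∷ 0ℤ ∷ []) ∷ (0ℤ ∷ 1ℤ ∷ []) ∷ [])
      ∷ ((-2ℤ ∷ 0ℤ ∷ []) ∷ (-1ℤ ∷ -1ℤ ∷ []) ∷ [])
      ∷ ((2ℤ ∷ 0ℤ ∷ []) ∷ (1ℤ ∷ 0ℤ ∷ []) ∷ [])
      ∷ []
liftG = ((0ℤ ∷ 1ℤ ∷ []) ∷ (0ℤ ∷ 1ℤ ∷ []) ∷ [])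
      ∷ ((0ℤ ∷ -2ℤ ∷ []) ∷ (-2ℤ ∷ -1ℤ ∷ []) ∷ [])
      ∷ ((0ℤ ∷ 1ℤ ∷ []) ∷ (2ℤ ∷ 0ℤ ∷ []) ∷ [])
      ∷ []

at : Vec (Vec (Vec ℤ 2) 2) 3 → Fin 3 → Cell (2 ∷ 2 ∷ []) → ℤ
at t j (a ∷ b ∷ []) = lookup (lookup (lookup t j) a) b

liftVector : Fin 3 × Cell (2 ∷ 2 ∷ []) × Cell (2 ∷ 2 ∷ []) → ℤ
liftVector (h , i , j) = χ i * (χ j * (at liftF h j - at liftG h i))

liftVector∈ : Lawrence 3 (Cuts (2 ∷ 2 ∷ []) (2 ∷ 2 ∷ [])) ∋ liftVector
liftVector∈ = (λ h → potential∈cuts bin bin (at liftF h) (at liftG h)) , balanced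
  where
  bin : Binary (2 ∷ 2 ∷ [])
  bin = refl ∷ refl ∷ []
  balanced : ∀ c → sum (λ h → liftVector (h , c)) ≡ 0ℤ
  balanced ((a ∷ b ∷ []) , (c ∷ e ∷ [])) = toWitness
    {a? = Fin.all? λ a → Fin.all? λ b → Fin.all? λ c → Fin.all? λ e →
      sum (λ h → liftVector (h , (a ∷ b ∷ []) , (c ∷ e ∷ []))) ℤ.≟ 0ℤ} _ a b c e

-- A single slice is a binary cut space, which is regular and so cannot force a ratio of -2. The
-- chain therefore passes to slice 2 at a cell where slice 0 vanishes, moves there by a row
-- equation, and returns to slice 1; the last equation again balances 1, 1 and -2.
liftVector-forced : ∀ w → Lawrence 3 (Cuts (2 ∷ 2 ∷ []) (2 ∷ 2 ∷ [])) ∋ w → w ⊑ liftVector →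
  w (1F , (0F ∷ 0F ∷ []) , (1F ∷ 0F ∷ [])) ≡ 0ℤ → w (1F , (0F ∷ 0F ∷ []) , (0F ∷ 0F ∷ [])) ≡ 0ℤ
liftVector-forced w w∈ w⊑ w≡0 = w5≡0
  where
  vanish : ∀ c → liftVector c ≡ 0ℤ → w c ≡ 0ℤ
  vanish c = ⊑-zero w⊑ {c}
  w1≡0 : w (2F , (0F ∷ 0F ∷ []) , (1F ∷ 0F ∷ [])) ≡ 0ℤ
  w1≡0 = sum-forced (λ j → w (j , (0F ∷ 0F ∷ []) , (1F ∷ 0F ∷ [])))
    (proj₂ w∈ ((0F ∷ 0F ∷ []) , (1F ∷ 0F ∷ []))) 2F λ
    { 0F → inj₂ (vanish (0F , (0F ∷ 0F ∷ []) , (1F ∷ 0F ∷ [])) refl)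
    ; 1F → inj₂ w≡0
    ; 2F → inj₁ refl
    }
  w2≡0 : w (2F , (0F ∷ 1F ∷ []) , (1F ∷ 1F ∷ [])) ≡ 0ℤ
  w2≡0 = sums-forced (λ a b → w (2F , (0F ∷ a ∷ []) , (1F ∷ b ∷ [])))
    (proj₁ w∈ 2F (there 0F (here [])) (there 1F (here []))) 1F 1F λ
    { 0F 0F → inj₂ w1≡0
    ; 0F 1F → inj₂ (vanish (2F , (0F ∷ 0F ∷ []) , (1F ∷ 1F ∷ [])) refl)
    ; 1F 0F → inj₂ (vanish (2F , (0F ∷ 1F ∷ []) , (1F ∷ 0F ∷ [])) refl)
    ; 1F 1F → inj₁ (refl , refl)
    }
  w3≡0 : w (1F , (0F ∷ 1F ∷ []) , (1F ∷ 1F ∷ [])) ≡ 0ℤ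
  w3≡0 = sum-forced (λ j → w (j , (0F ∷ 1F ∷ []) , (1F ∷ 1F ∷ [])))
    (proj₂ w∈ ((0F ∷ 1F ∷ []) , (1F ∷ 1F ∷ []))) 1F λ
    { 0F → inj₂ (vanish (0F , (0F ∷ 1F ∷ []) , (1F ∷ 1F ∷ [])) refl)
    ; 1F → inj₁ refl
    ; 2F → inj₂ w2≡0
    }
  w4≡0 : w (1F , (0F ∷ 1F ∷ []) , (1F ∷ 0F ∷ [])) ≡ 0ℤ
  w4≡0 = sums-forced (λ a b → w (1F , (a ∷ 1F ∷ []) , (1F ∷ b ∷ [])))
    (proj₁ w∈ 1F (here (1F ∷ [])) (there 1F (here []))) 0F 0F λ
    { 0F 0F → inj₁ (refl , refl)
    ; 0F 1F → inj₂ w3≡0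
    ; 1F 0F → inj₂ (vanish (1F , (1F ∷ 1F ∷ []) , (1F ∷ 0F ∷ [])) refl)
    ; 1F 1F → inj₂ (vanish (1F , (1F ∷ 1F ∷ []) , (1F ∷ 1F ∷ [])) refl)
    }
  w5≡0 : w (1F , (0F ∷ 0F ∷ []) , (0F ∷ 0F ∷ [])) ≡ 0ℤ
  w5≡0 = sums-forced (λ a b → w (1F , (0F ∷ a ∷ []) , (b ∷ 0F ∷ [])))
    (proj₁ w∈ 1F (there 0F (here [])) (here (0F ∷ []))) 0F 0F λ
    { 0F 0F → inj₁ (refl , refl)
    ; 0F 1F → inj₂ w≡0
    ; 1F 0F → inj₂ (vanish (1F , (0F ∷ 1F ∷ []) , (0F ∷ 0F ∷ [])) refl)
    ; 1F 1F → inj₂ w4≡0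
    }

lift-irregular : ¬ Regular (Lawrence 3 (Cuts (2 ∷ 2 ∷ []) (2 ∷ 2 ∷ [])))
lift-irregular = irregular (Lawrence 3 (Cuts _ _)) liftVector∈ refl refl liftVector-forced

-- Circuits of matrices

∑ᴸ : List A → (A → ℤ) → ℤ
∑ᴸ cs f = List.foldr (λ c s → f c + s) 0ℤ cs

∑ᴸ-cong : ∀ (cs : List A) {f g} → f ≗ g → ∑ᴸ cs f ≡ ∑ᴸ cs g
∑ᴸ-cong []       f≗g = refl
∑ᴸ-cong (c ∷ cs) f≗g = cong₂ _+_ (f≗g c) (∑ᴸ-cong cs f≗g)

∑ᴸ-linear : ∀ (cs : List A) a b (f g : A → ℤ) →
            ∑ᴸ cs (λ c → a * f c + b * g c) ≡ a * ∑ᴸ cs f + b * ∑ᴸ cs g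
∑ᴸ-linear []       a b f g = sym (linear-zero a b refl refl)
∑ᴸ-linear (c ∷ cs) a b f g = trans (cong (a * f c + b * g c +_) (∑ᴸ-linear cs a b f g))
  (regroup a b (f c) (g c) (∑ᴸ cs f) (∑ᴸ cs g))
  where
  regroup : ∀ a b u v s t → a * u + b * v + (a * s + b * t) ≡ a * (u + s) + b * (v + t)
  regroup = solve-∀

∑ᴸ-scale : ∀ (cs : List A) z (f : A → ℤ) → ∑ᴸ cs (λ c → z * f c) ≡ z * ∑ᴸ cs f
∑ᴸ-scale []       z f = sym (ℤ.*-zeroʳ z)
∑ᴸ-scale (c ∷ cs) z f =
  trans (cong (z * f c +_) (∑ᴸ-scale cs z f)) (sym (ℤ.*-distribˡ-+ z (f c) (∑ᴸ cs f)))

kernel : (M : Matrix) → Space (Matrix.Col M)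
kernel M = record
  { _∋_      = InKernel
  ; respects = λ x≗y x∈ r → trans (∑ᴸ-cong columns λ c → cong (entry r c *_) (sym (x≗y c))) (x∈ r)
  ; linear   = λ a b {x} {y} x∈ y∈ r → begin
      ∑ (λ c → entry r c * (a * x c + b * y c))
        ≡⟨ ∑ᴸ-cong columns (λ c → distrib (entry r c) a b (x c) (y c)) ⟩
      ∑ (λ c → a * (entry r c * x c) + b * (entry r c * y c))
        ≡⟨ ∑ᴸ-linear columns a b _ _ ⟩
      a * ∑ (λ c → entry r c * x c) + b * ∑ (λ c → entry r c * y c)
        ≡⟨ linear-zero a b (x∈ r) (y∈ r) ⟩
      0ℤ ∎ }
  where
  open Matrix M
  open ≡-Reasoning
  distrib : ∀ e a b u v → e * (a * u + b * v) ≡ a * (e * u) + b * (e * v)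
  distrib = solve-∀

support : ℤ → ℕ
support (ℤ.+ zero) = 0
support _          = 1

support-mono : ∀ {z w} → (z ≢ 0ℤ → w ≢ 0ℤ) → support z ≤ support w
support-mono {ℤ.+ zero}           _   = z≤n
support-mono {ℤ.+ suc _} {ℤ.+ zero}  imp = contradiction refl (imp λ ())
support-mono {ℤ.+ suc _} {ℤ.+ suc _} imp = s≤s z≤n
support-mono {ℤ.+ suc _} { -[1+ _ ]} imp = s≤s z≤n
support-mono { -[1+ _ ]} {ℤ.+ zero}  imp = contradiction refl (imp λ ())
support-mono { -[1+ _ ]} {ℤ.+ suc _} imp = s≤s z≤n
support-mono { -[1+ _ ]} { -[1+ _ ]} imp = s≤s z≤n

support-strict : ∀ {z w} → z ≡ 0ℤ → w ≢ 0ℤ → support z ℕ.< support w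
support-strict {w = ℤ.+ zero}  refl w≢0 = contradiction refl w≢0
support-strict {w = ℤ.+ suc _} refl w≢0 = s≤s z≤n
support-strict {w = -[1+ _ ]}  refl w≢0 = s≤s z≤n

supportSize : List A → (A → ℤ) → ℕ
supportSize []       x = 0
supportSize (c ∷ cs) x = support (x c) ℕ.+ supportSize cs x

supportSize-mono : ∀ (cs : List A) {y x} → y ⊑ x → supportSize cs y ≤ supportSize cs x
supportSize-mono []       y⊑x = z≤n
supportSize-mono (c ∷ cs) y⊑x = ℕ.+-mono-≤ (support-mono (y⊑x c)) (supportSize-mono cs y⊑x)

supportSize-strict : ∀ {cs : List A} {y x c} → c ∈ˡ cs → y ⊑ x → y c ≡ 0ℤ → x c ≢ 0ℤ →
                     supportSize cs y ℕ.< supportSize cs x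
supportSize-strict {cs = _ ∷ cs} (Any.here refl) y⊑x yc≡0 xc≢0 =
  ℕ.+-mono-<-≤ (support-strict yc≡0 xc≢0) (supportSize-mono cs y⊑x)
supportSize-strict (Any.there c∈) y⊑x yc≡0 xc≢0 =
  ℕ.+-mono-≤-< (support-mono (y⊑x _)) (supportSize-strict c∈ y⊑x yc≡0 xc≢0)

SupportMinimal : Space A → (A → ℤ) → Set
SupportMinimal K x = ∀ y → K ∋ y → (∃ λ c → y c ≢ 0ℤ) → y ⊑ x → x ⊑ y

-- When y c vanishes, eliminating the entry e of x by means of y keeps x c ≠ 0.
minimal-support : (K : Space A) {cs : List A} → (∀ c → c ∈ˡ cs) →
  ∀ n x → supportSize cs x ℕ.< n → K ∋ x → ∀ {c} → x c ≢ 0ℤ →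
  ¬ ¬ (∃ λ z → K ∋ z × z c ≢ 0ℤ × z ⊑ x × SupportMinimal K z)
minimal-support {A = A} K {cs} all∈ (suc n) x (s≤s size≤n) x∈ {c} xc≢0 k =
  k (x , x∈ , xc≢0 , (λ _ → id) , minimal)
  where
  -- A vector below `x` that keeps `c` but loses another entry has smaller support, so the induction
  -- would already produce the vector that `k` excludes.
  descend : ∀ y → K ∋ y → y c ≢ 0ℤ → y ⊑ x → ∀ e → y e ≡ 0ℤ → x e ≡ 0ℤ
  descend y y∈ yc≢0 y⊑x e ye≡0 = stable λ xe≢0 →
    minimal-support K all∈ n y (ℕ.<-≤-trans (supportSize-strict (all∈ e) y⊑x ye≡0 xe≢0) size≤n)
      y∈ yc≢0 λ { (z , z∈ , zc≢0 , z⊑y , min) → k (z , z∈ , zc≢0 , (λ e → y⊑x e ∘ z⊑y e) , min) }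

  minimal : SupportMinimal K x
  minimal y y∈ (e , ye≢0) y⊑x f xf≢0 yf≡0 with y c ℤ.≟ 0ℤ
  ... | no yc≢0  = xf≢0 (descend y y∈ yc≢0 y⊑x f yf≡0)
  ... | yes yc≡0 = y⊑x e ye≢0 (descend w (linear K (y e) (- x e) x∈ y∈) wc≢0 w⊑x e we≡0)
    where
    w : A → ℤ
    w b = y e * x b + - x e * y b
    we≡0 : w e ≡ 0ℤ
    we≡0 = cancel (y e) (x e)
      where
      cancel : ∀ u v → u * v + - v * u ≡ 0ℤ
      cancel = solve-∀
    wc≢0 : w c ≢ 0ℤ
    wc≢0 wc≡0 = *-≢0 ye≢0 xc≢0 (begin
      y e * x c                  ≡⟨ tidy (y e * x c) (- x e) ⟩
      y e * x c + - x e * 0ℤ     ≡⟨ cong (λ z → y e * x c + - x e * z) yc≡0 ⟨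
      w c                        ≡⟨ wc≡0 ⟩
      0ℤ                         ∎)
      where
      open ≡-Reasoning
      tidy : ∀ u v → u ≡ u + v * 0ℤ
      tidy = solve-∀
    w⊑x : w ⊑ x
    w⊑x b wb≢0 xb≡0 = wb≢0 (linear-zero (y e) (- x e) xb≡0 (⊑-zero y⊑x xb≡0))

∣∣≡1⇒isSign : ∀ z → ℤ.∣ z ∣ ≡ 1 → IsSign z
∣∣≡1⇒isSign (ℤ.+ _)  refl = inj₂ (inj₁ refl)
∣∣≡1⇒isSign -[1+ 0 ] refl = inj₂ (inj₂ refl)

isSign? : ∀ z → Dec (IsSign z)
isSign? z = (z ℤ.≟ 0ℤ) ⊎-dec (z ℤ.≟ 1ℤ) ⊎-dec (z ℤ.≟ -1ℤ)

unit-square : ∀ {u} → IsSign u → u ≢ 0ℤ → u * u ≡ 1ℤ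
unit-square (inj₁ u≡0)         u≢0 = contradiction u≡0 u≢0
unit-square (inj₂ (inj₁ refl)) _   = refl
unit-square (inj₂ (inj₂ refl)) _   = refl

module _ (M : Matrix) where
  open Matrix M hiding (Unimodular)
  open IsCircuit

  -- Subtracting from the circuit `x` the multiple of a sign vector `y` that clears the entry at `c`
  -- leaves 0 by minimality. Thus `x` is a multiple of `y`, so `x c` divides every entry and must be
  -- a unit.
  regular⇒unimodular : Regular (kernel M) → Unimodular M
  regular⇒unimodular reg x circ c with x c ℤ.≟ 0ℤ
  ... | yes xc≡0 = inj₁ xc≡0
  ... | no xc≢0  = decidable-stable (isSign? (x c)) λ k →
    reg x (inKernel circ) c xc≢0 λ { (y , y∈ , sgn , yc≢0 , y⊑x) →
      k (∣∣≡1⇒isSign (x c) (relativelyPrime circ ℤ.∣ x c ∣ (multiple y y∈ (sgn c) yc≢0 y⊑x))) }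
    where
    module _ (y : Col → ℤ) (y∈ : InKernel y) (sgn : IsSign (y c)) (yc≢0 : y c ≢ 0ℤ) (y⊑x : y ⊑ x) where
      t : ℤ
      t = x c * y c

      w : Col → ℤ
      w e = 1ℤ * x e + - t * y e

      wc≡0 : w c ≡ 0ℤ
      wc≡0 = begin
        1ℤ * x c + - (x c * y c) * y c  ≡⟨ tidy (x c) (y c) ⟩
        x c - x c * (y c * y c)         ≡⟨ cong (λ z → x c - x c * z) (unit-square sgn yc≢0) ⟩
        x c - x c * 1ℤ                  ≡⟨ cancel (x c) ⟩
        0ℤ                              ∎
        where
        open ≡-Reasoning
        tidy : ∀ u v → 1ℤ * u + - (u * v) * v ≡ u - u * (v * v)
        tidy = solve-∀
        cancel : ∀ u → u - u * 1ℤ ≡ 0ℤ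
        cancel = solve-∀

      w≡0 : ∀ e → w e ≡ 0ℤ
      w≡0 e = stable λ we≢0 →
        minimal circ w (linear (kernel M) 1ℤ (- t) (inKernel circ) y∈) (e , we≢0)
          (λ b wb≢0 xb≡0 → wb≢0 (linear-zero 1ℤ (- t) xb≡0 (⊑-zero y⊑x xb≡0)))
          c xc≢0 wc≡0

      multiple : ∀ e → ℤ.∣ x c ∣ ℕ.∣ ℤ.∣ x e ∣
      multiple e = ℕ.divides ℤ.∣ y c * y e ∣ (begin
        ℤ.∣ x e ∣                        ≡⟨ cong ℤ.∣_∣ (begin
          x e                              ≡⟨ tidy (x e) (x c) (y c) (y e) ⟩
          w e + y c * y e * x c            ≡⟨ cong (_+ y c * y e * x c) (w≡0 e) ⟩
          0ℤ + y c * y e * x c             ≡⟨ ℤ.+-identityˡ _ ⟩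
          y c * y e * x c                  ∎) ⟩
        ℤ.∣ y c * y e * x c ∣            ≡⟨ ℤ.abs-* (y c * y e) (x c) ⟩
        ℤ.∣ y c * y e ∣ ℕ.* ℤ.∣ x c ∣    ∎)
        where
        open ≡-Reasoning
        tidy : ∀ u v p q → u ≡ 1ℤ * u + - (v * p) * q + p * q * v
        tidy = solve-∀

  -- No gcd is computed: dividing by any common divisor other than 1 keeps the support and lowers
  -- the absolute value at `c`, which `n` bounds.
  primitive-circuit : ∀ n z {c} → ℤ.∣ z c ∣ ℕ.< n → InKernel z → z c ≢ 0ℤ →
                      SupportMinimal (kernel M) z →
                      ¬ ¬ (∃ λ z′ → IsCircuit z′ × z′ c ≢ 0ℤ × z′ ⊑ z)
  primitive-circuit (suc n) z {c} (s≤s ∣zc∣≤n) z∈ zc≢0 min k = k (z , circuit , zc≢0 , λ _ → id)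
    where
    prime : RelativelyPrime z
    prime g g∣z = decidable-stable (g ℕ.≟ 1) λ g≢1 →
      primitive-circuit n q (ℕ.<-≤-trans (∣qc∣<∣zc∣ g≢1) ∣zc∣≤n) q∈ (z⊑q c zc≢0)
        (λ y y∈ y≢0 y⊑q c qc≢0 → min y y∈ y≢0 (λ e → q⊑z e ∘ y⊑q e) c (q⊑z c qc≢0))
        λ { (z′ , circ , z′c≢0 , z′⊑q) → k (z′ , circ , z′c≢0 , λ e → q⊑z e ∘ z′⊑q e) }
      where
      q : Col → ℤ
      q e = _∣ˢ_.quotient (∣ᵤ⇒∣ {ℤ.+ g} {z e} (g∣z e))

      z≡qg : ∀ e → z e ≡ q e * ℤ.+ g
      z≡qg e = _∣ˢ_.equality (∣ᵤ⇒∣ {ℤ.+ g} {z e} (g∣z e))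

      qg≢0 : q c * ℤ.+ g ≢ 0ℤ
      qg≢0 = zc≢0 ∘ trans (z≡qg c)

      g≢0 : ℤ.+ g ≢ 0ℤ
      g≢0 = ≢-factorʳ (q c) (ℤ.+ g) qg≢0

      z⊑q : z ⊑ q
      z⊑q e ze≢0 = ≢-factorˡ (q e) (ℤ.+ g) (ze≢0 ∘ trans (z≡qg e))

      q⊑z : q ⊑ z
      q⊑z e qe≢0 = *-≢0 qe≢0 g≢0 ∘ trans (sym (z≡qg e))

      q∈ : InKernel q
      q∈ r = stable λ ∑≢0 → *-≢0 g≢0 ∑≢0 (begin
        ℤ.+ g * ∑ (λ e → entry r e * q e)
          ≡⟨ ∑ᴸ-scale columns (ℤ.+ g) (λ e → entry r e * q e) ⟨
        ∑ (λ e → ℤ.+ g * (entry r e * q e))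
          ≡⟨ ∑ᴸ-cong columns (λ e → trans (rotate (ℤ.+ g) (entry r e) (q e))
               (cong (entry r e *_) (sym (z≡qg e)))) ⟩
        ∑ (λ e → entry r e * z e)
          ≡⟨ z∈ r ⟩
        0ℤ ∎)
        where
        open ≡-Reasoning
        rotate : ∀ u v w → u * (v * w) ≡ v * (w * u)
        rotate = solve-∀

      ∣qc∣<∣zc∣ : g ≢ 1 → ℤ.∣ q c ∣ ℕ.< ℤ.∣ z c ∣
      ∣qc∣<∣zc∣ g≢1 = subst (ℤ.∣ q c ∣ ℕ.<_)
        (sym (trans (cong ℤ.∣_∣ (z≡qg c)) (ℤ.abs-* (q c) (ℤ.+ g))))
        (ℕ.m<m*n ℤ.∣ q c ∣ g {{ℕ.≢-nonZero (z⊑q c zc≢0 ∘ ℤ.∣i∣≡0⇒i≡0)}}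
          (ℕ.≤∧≢⇒< (ℕ.n≢0⇒n>0 (λ g≡0 → g≢0 (cong (λ m → ℤ.+ m) g≡0))) (≢-sym g≢1)))

    circuit : IsCircuit z
    circuit = record
      { inKernel = z∈ ; nonzero = c , zc≢0 ; relativelyPrime = prime ; minimal = min }

  unimodular⇒regular : Unimodular M → Regular (kernel M)
  unimodular⇒regular uni x x∈ c xc≢0 k =
    minimal-support (kernel M) complete _ x ℕ.≤-refl x∈ xc≢0
      λ { (z , z∈ , zc≢0 , z⊑x , min) → primitive-circuit _ z ℕ.≤-refl z∈ zc≢0 min
        λ { (y , circ , yc≢0 , y⊑z) →
          k (y , inKernel circ , uni y circ , yc≢0 , λ e → z⊑x e ∘ y⊑z e) } }

∑ᴸ-product : ∀ (as : List.List A) (bs : List.List B) (g : A → B → E) (f : E → ℤ) →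
             ∑ᴸ (List.cartesianProductWith g as bs) f ≡ ∑ᴸ as (λ a → ∑ᴸ bs (λ b → f (g a b)))
∑ᴸ-product List.[]       bs g f = refl
∑ᴸ-product (a List.∷ as) bs g f = begin
  ∑ᴸ (List.map (g a) bs List.++ List.cartesianProductWith g as bs) f
    ≡⟨ ∑ᴸ-++ (List.map (g a) bs) ⟩
  ∑ᴸ (List.map (g a) bs) f + ∑ᴸ (List.cartesianProductWith g as bs) f
    ≡⟨ cong₂ _+_ (List.foldr-map (λ c s → f c + s) (g a) 0ℤ bs) (∑ᴸ-product as bs g f) ⟩
  ∑ᴸ bs (f ∘ g a) + ∑ᴸ as (λ a → ∑ᴸ bs (λ b → f (g a b))) ∎
  where
  open ≡-Reasoning
  ∑ᴸ-++ : ∀ cs {ds} → ∑ᴸ (cs List.++ ds) f ≡ ∑ᴸ cs f + ∑ᴸ ds f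
  ∑ᴸ-++ List.[]       = sym (ℤ.+-identityˡ _)
  ∑ᴸ-++ (c List.∷ cs) = trans (cong (f c +_) (∑ᴸ-++ cs)) (sym (ℤ.+-assoc (f c) _ _))

∑ᴸ-tabulate : ∀ (g : Fin n → A) (f : A → ℤ) → ∑ᴸ (List.tabulate g) f ≡ sum (f ∘ g)
∑ᴸ-tabulate {zero}  g f = refl
∑ᴸ-tabulate {suc n} g f = cong (f (g zero) +_) (∑ᴸ-tabulate (g ∘ suc) f)

∑ᴸ-zero : ∀ (cs : List.List A) → ∑ᴸ cs (λ _ → 0ℤ) ≡ 0ℤ
∑ᴸ-zero List.[]       = refl
∑ᴸ-zero (_ List.∷ cs) = trans (ℤ.+-identityˡ _) (∑ᴸ-zero cs)

sum-∑ᴸ : ∀ (cs : List.List A) (f : Fin n → A → ℤ) →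
         sum (λ j → ∑ᴸ cs (f j)) ≡ ∑ᴸ cs (λ c → sum (λ j → f j c))
sum-∑ᴸ {n = n} List.[] f = sum-replicate-zero n
sum-∑ᴸ (c List.∷ cs) f = trans (∑-distrib-+ (λ j → f j c) (λ j → ∑ᴸ cs (f j)))
  (cong (sum (λ j → f j c) +_) (sum-∑ᴸ cs f))

∑-cells : ∀ n (d : Vec ℕ k) (f : Cell (n ∷ d) → ℤ) →
          ∑ᴸ (allCells (n ∷ d)) f ≡ sum (λ j → ∑ᴸ (allCells d) (λ i → f (j ∷ i)))
∑-cells n d f = trans (∑ᴸ-product (List.allFin n) (allCells d) _∷_ f) 
  (∑ᴸ-tabulate {n = n} id (λ j → ∑ᴸ (allCells d) (λ i → f (j ∷ i))))

-- Kernels and facets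

-- The row sum of `𝒜` in recursive form, with the vertices outside `F` summed out one at a time;
-- `∑-marginal` identifies the two.
marginal : (F : Subset k) {d : Vec ℕ k} → Cell (select F d) → (Cell d → ℤ) → ℤ
marginal []            {[]}    e       x = x []
marginal (inside ∷ F)  {_ ∷ _} (j ∷ e) x = marginal F e (x ∘ (j ∷_))
marginal (outside ∷ F) {_ ∷ _} e       x = marginal F e (λ i → sum λ j → x (j ∷ i))

marginal-cong : (F : Subset k) {d : Vec ℕ k} (e : Cell (select F d)) {x y : Cell d → ℤ} →
                x ≗ y → marginal F e x ≡ marginal F e y
marginal-cong []            {[]}    e       x≗y = x≗y []
marginal-cong (inside ∷ F)  {_ ∷ _} (j ∷ e) x≗y = marginal-cong F e (x≗y ∘ (j ∷_))
marginal-cong (outside ∷ F) {n ∷ _} e       x≗y =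
  marginal-cong F e (λ i → sum-cong-≗ {n} (λ j → x≗y (j ∷ i)))

marginal-linear : (F : Subset k) {d : Vec ℕ k} (e : Cell (select F d)) (a b : ℤ)
                  (x y : Cell d → ℤ) →
                  marginal F e (λ i → a * x i + b * y i) ≡ a * marginal F e x + b * marginal F e y
marginal-linear []            {[]}    e       a b x y = refl
marginal-linear (inside ∷ F)  {_ ∷ _} (j ∷ e) a b x y =
  marginal-linear F e a b (x ∘ (j ∷_)) (y ∘ (j ∷_))
marginal-linear (outside ∷ F) {n ∷ _} e       a b x y = trans
  (marginal-cong F e (λ i → sum-linear {n} a b (λ j → x (j ∷ i)) (λ j → y (j ∷ i))))
  (marginal-linear F e a b _ _)

∑-marginal : (F : Subset k) {d : Vec ℕ k} (e : Cell (select F d)) (x : Cell d → ℤ) →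
  ∑ᴸ (allCells d) (λ i → indicator _≟_ e (restrict F i) * x i) ≡ marginal F e x
∑-marginal []           {[]}    [] x = trans (ℤ.+-identityʳ _) (ℤ.*-identityˡ (x []))
∑-marginal (inside ∷ F) {n ∷ d} (j ∷ e) x = begin
  ∑ᴸ (allCells (n ∷ d)) (λ i → indicator _≟_ (j ∷ e) (restrict (inside ∷ F) i) * x i)
    ≡⟨ ∑-cells n d (λ i → indicator _≟_ (j ∷ e) (restrict (inside ∷ F) i) * x i) ⟩
  sum (λ h → slice h (does (j Fin.≟ h)))
    ≡⟨ sum-concentrated j _ concentrated ⟩
  slice j (does (j Fin.≟ j))
    ≡⟨ cong (slice j) (dec-true (j Fin.≟ j) refl) ⟩
  slice j true
    ≡⟨ ∑-marginal F e (x ∘ (j ∷_)) ⟩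
  marginal F e (x ∘ (j ∷_)) ∎
  where
  open ≡-Reasoning
  -- The test for equality of two conses reduces to a conjunction. Abstracting its first factor as
  -- `b` allows it to be replaced by its value in each slice.
  slice : Fin n → Bool → ℤ
  slice h b = ∑ᴸ (allCells d)
    (λ i → (if b ∧ does (e ≟ restrict F i) then 1ℤ else 0ℤ) * x (h ∷ i))
  concentrated : (λ h → slice h (does (j Fin.≟ h))) ⊑ δ j
  concentrated h slice≢0 δ≡0 =
    slice≢0 (trans (cong (slice h) (dec-false (j Fin.≟ h) j≢h)) (∑ᴸ-zero (allCells d)))
    where
    j≢h : j ≢ h
    j≢h refl = contradiction (trans (sym (δ-refl j)) δ≡0) λ ()
∑-marginal (outside ∷ F) {n ∷ d} e x = begin
  ∑ᴸ (allCells (n ∷ d)) (λ i → indicator _≟_ e (restrict (outside ∷ F) i) * x i)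
    ≡⟨ ∑-cells n d (λ i → indicator _≟_ e (restrict (outside ∷ F) i) * x i) ⟩
  sum (λ j → ∑ᴸ (allCells d) (λ i → indicator _≟_ e (restrict F i) * x (j ∷ i)))
    ≡⟨ sum-∑ᴸ {n = n} (allCells d) (λ j i → indicator _≟_ e (restrict F i) * x (j ∷ i)) ⟩
  ∑ᴸ (allCells d) (λ i → sum λ j → indicator _≟_ e (restrict F i) * x (j ∷ i))
    ≡⟨ ∑ᴸ-cong (allCells d) (λ i →
         *-distribˡ-sum {n} (indicator _≟_ e (restrict F i)) (λ j → x (j ∷ i))) ⟨
  ∑ᴸ (allCells d) (λ i → indicator _≟_ e (restrict F i) * sum λ j → x (j ∷ i))
    ≡⟨ ∑-marginal F e _ ⟩
  marginal F e (λ i → sum λ j → x (j ∷ i)) ∎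
  where open ≡-Reasoning

Marginals : (Subset k → Set) → (d : Vec ℕ k) → Space (Cell d)
Marginals P d = record
  { _∋_      = λ x → ∀ F → P F → ∀ e → marginal F e x ≡ 0ℤ
  ; respects = λ x≗y x∈ F PF e → trans (marginal-cong F e (sym ∘ x≗y)) (x∈ F PF e)
  ; linear   = λ a b {x} {y} x∈ y∈ F PF e →
      trans (marginal-linear F e a b x y) (linear-zero a b (x∈ F PF e) (y∈ F PF e)) }

marginals-cong : {P Q : Subset k → Set} {d : Vec ℕ k} →
                 (∀ {F} → P F → Q F) → (∀ {F} → Q F → P F) → Marginals P d ≐ Marginals Q d
marginals-cong P⇒Q Q⇒P = equal (λ x∈ F QF → x∈ F (Q⇒P QF)) (λ x∈ F PF → x∈ F (P⇒Q PF))

kernel≐marginals : (C : Complex k) (d : Vec ℕ k) → kernel (𝒜 C d) ≐ Marginals (Facet C) d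
kernel≐marginals C d = equal
  (λ {x} x∈ F f e → trans (sym (∑-marginal F e x)) (x∈ (F , f , e)))
  (λ {x} x∈ (F , f , e) → trans (∑-marginal F e x) (x∈ F f e))

-- Facets of the constructed complexes

Antichain : (Subset k → Set) → Set
Antichain P = ∀ {S T} → P S → P T → S ⊆ T → T ⊆ S

facet⇒generator : {P : Subset k → Set} → ∀ {S} → Facet (generatedBy P) S → P S
facet⇒generator {P = P} ((T , PT , S⊆T) , max) =
  subst P (⊆-antisym (max T (T , PT , ⊆-refl) S⊆T) S⊆T) PT

generator⇒facet : {P : Subset k → Set} → Antichain P → ∀ {S} → P S → Facet (generatedBy P) S
generator⇒facet anti {S} PS =
  (S , PS , ⊆-refl) , λ { T (U , PU , T⊆U) S⊆T → ⊆-trans T⊆U (anti PS PU (⊆-trans S⊆T T⊆U)) }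

facet-antichain : (C : Complex k) → Antichain (Facet C)
facet-antichain C (_ , max) (fT , _) = max _ fT

-- Stated for any family `P`, so that cone vertices can be peeled off one by one without
-- interpreting the intermediate families as facets of a complex.
ConeFamily : ∀ p → (Subset k → Set) → Subset (p ℕ.+ k) → Set
ConeFamily p P T = ∃ λ F → P F × T ≡ ⊤ {p} ++ F

⊤++-⊆⁻ : ∀ p {F F′ : Subset k} → ⊤ {p} ++ F ⊆ ⊤ {p} ++ F′ → F ⊆ F′
⊤++-⊆⁻ zero    F⊆F′ = F⊆F′
⊤++-⊆⁻ (suc p) F⊆F′ = ⊤++-⊆⁻ p (drop-∷-⊆ F⊆F′)

⊤++-⊆⁺ : ∀ p {F F′ : Subset k} → F ⊆ F′ → ⊤ {p} ++ F ⊆ ⊤ {p} ++ F′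
⊤++-⊆⁺ zero    F⊆F′ = F⊆F′
⊤++-⊆⁺ (suc p) F⊆F′ = s⊆s (⊤++-⊆⁺ p F⊆F′)

cone-facets : ∀ p (C : Complex k) (d : Vec ℕ (p ℕ.+ k)) →
              Marginals (Facet (cone p C)) d ≐ Marginals (ConeFamily p (Facet C)) d
cone-facets p C d = marginals-cong facet⇒generator
  (generator⇒facet λ { (F , f , refl) (F′ , f′ , refl) S⊆T →
    ⊤++-⊆⁺ p (facet-antichain C f f′ (⊤++-⊆⁻ p S⊆T)) })

cone-zero : {P : Subset k → Set} {d : Vec ℕ k} → Marginals (ConeFamily 0 P) d ≐ Marginals P d
cone-zero = marginals-cong (λ { (F , PF , refl) → PF }) (λ PF → _ , PF , refl)

cone-suc : ∀ p {P : Subset k → Set} {d : Vec ℕ (p ℕ.+ k)} →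
           Marginals (ConeFamily (suc p) P) (n ∷ d) ≐
           reindex cons↔ (Slices n (Marginals (ConeFamily p P) d))
cone-suc p = equal
  (λ { x∈ j .(⊤ {p} ++ F) (F , PF , refl) e → x∈ (⊤ {suc p} ++ F) (F , PF , refl) (j ∷ e) })
  (λ { x∈ .(⊤ {suc p} ++ F) (F , PF , refl) (j ∷ e) → x∈ j (⊤ {p} ++ F) (F , PF , refl) e })

cone-minor : ∀ p {P : Subset k → Set} (d : Vec ℕ (p ℕ.+ k)) → (∀ v → 2 ≤ lookup d v) →
             Minor (Marginals (ConeFamily p P) d) (Marginals P (drop p d))
cone-minor zero    d             d≥2 = ≐⇒minor cone-zero
cone-minor (suc p) (zero ∷ d)    d≥2 = contradiction (d≥2 zero) λ ()
cone-minor (suc p) {P} (suc n ∷ d) d≥2 = minor-trans (≐⇒minor (cone-suc p {P}))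
  (minor-trans (reindex-minor cons↔ {Slices _ (Marginals (ConeFamily p P) d)})
    (minor-trans slices-minor (cone-minor p d (d≥2 ∘ suc))))

regular-cone : ∀ p {P : Subset k → Set} (d : Vec ℕ (p ℕ.+ k)) →
               Regular (Marginals P (drop p d)) → Regular (Marginals (ConeFamily p P) d)
regular-cone zero    d       reg = regular-minor (≐⇒minor (≐-sym cone-zero)) reg
regular-cone (suc p) {P} (n ∷ d) reg = regular-minor
  (minor-trans (minor-reindex cons↔ {Slices _ (Marginals (ConeFamily p P) d)})
    (≐⇒minor (≐-sym (cone-suc p {P}))))
  (regular-slices {K = Marginals (ConeFamily p P) d} (regular-cone p d reg))

G-facets : (C : Complex k) (d : Vec ℕ k) →
           Marginals (Facet (G C)) (n ∷ d) ≐ reindex cons↔ (Total n (Marginals (Facet C) d))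
G-facets C d = equal
  (λ x∈ F f e → x∈ (outside ∷ F) (shift f) e)
  (λ { x∈ .(outside ∷ F) ((F , fF , refl) , max) e → x∈ F (unshift F fF max) e })
  where
  shift : ∀ {F} → Facet C F → Facet (G C) (outside ∷ F)
  shift (fF , max) = (_ , fF , refl) ,
    λ { .(outside ∷ T) (T , fT , refl) F⊆T → s⊆s (max T fT (drop-∷-⊆ F⊆T)) }
  unshift : ∀ F → Face C F → (∀ T → Face (G C) T → outside ∷ F ⊆ T → T ⊆ outside ∷ F) → Facet C F
  unshift F fF max = fF ,
    λ T fT F⊆T → drop-∷-⊆ (max (outside ∷ T) (T , fT , refl) (s⊆s F⊆T))

marginal-⊤ : {d : Vec ℕ k} (e : Cell (select (⊤ {k}) d)) →
             ∃ λ i → ∀ x → marginal (⊤ {k}) {d} e x ≡ x i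
marginal-⊤ {d = []}    e       = [] , λ x → refl
marginal-⊤ {d = n ∷ d} (j ∷ e) with marginal-⊤ {d = d} e
... | i , eq = j ∷ i , λ x → eq (x ∘ (j ∷_))

marginal-⊤⁻ : {d : Vec ℕ k} (i : Cell d) → ∃ λ e → ∀ x → marginal (⊤ {k}) {d} e x ≡ x i
marginal-⊤⁻ []      = [] , λ x → refl
marginal-⊤⁻ (j ∷ i) with marginal-⊤⁻ i
... | e , eq = j ∷ e , λ x → eq (x ∘ (j ∷_))

⊤⊆⇒≡ : {S : Subset k} → ⊤ ⊆ S → S ≡ ⊤
⊤⊆⇒≡ = ⊆-antisym ⊆⊤

-- The facet `outside ∷ ⊤` contributes the vanishing of the sums over slices, the others the
-- membership of each slice. If `⊤` were a face of `C`, then `outside ∷ ⊤` would lie below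
-- `inside ∷ ⊤` and the first condition would be lost.
Λ-facets : (C : Complex k) → ¬ Face C ⊤ → (d : Vec ℕ k) →
           Marginals (Facet (Λ C)) (n ∷ d) ≐ reindex cons↔ (Lawrence n (Marginals (Facet C) d))
Λ-facets {k} {n} C ¬⊤ d = ≐-trans (marginals-cong facet⇒generator (generator⇒facet anti)) (equal
  (λ {x} x∈ →
    (λ j F f e → x∈ (inside ∷ F) (inj₂ (F , f , refl)) (j ∷ e)) ,
    λ i → let e , eq = marginal-⊤⁻ i in
      trans (sym (eq (λ i → sum {n} λ j → x (j ∷ i)))) (x∈ (outside ∷ ⊤) (inj₁ refl) e))
  λ { {x} (x∈ , x0) .(outside ∷ ⊤) (inj₁ refl) e → let i , eq = marginal-⊤ {d = d} e in
        trans (eq (λ i → sum {n} λ j → x (j ∷ i))) (x0 i)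
    ; (x∈ , x0) .(inside ∷ F) (inj₂ (F , f , refl)) (j ∷ e) → x∈ j F f e })
  where
  Family : Subset (suc k) → Set
  Family T = T ≡ outside ∷ ⊤ ⊎ (∃ λ F → Facet C F × T ≡ inside ∷ F)
  anti : Antichain Family
  anti (inj₁ refl) (inj₁ refl) _ = ⊆-refl
  anti (inj₁ refl) (inj₂ (F , (fF , _) , refl)) S⊆T =
    contradiction (subst (Face C) (⊤⊆⇒≡ (drop-∷-⊆ S⊆T)) fF) ¬⊤
  anti (inj₂ (_ , _ , refl)) (inj₁ refl) S⊆T with S⊆T here
  ... | ()
  anti (inj₂ (F , f , refl)) (inj₂ (F′ , f′ , refl)) S⊆T =
    s⊆s (facet-antichain C f f′ (drop-∷-⊆ S⊆T))

data OneOut : Subset k → Set where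
  here  : OneOut (outside ∷ ⊤ {k})
  there : {F : Subset k} → OneOut F → OneOut (inside ∷ F)

oneOut≢⊤ : {F : Subset k} → OneOut F → F ≢ ⊤
oneOut≢⊤ (there o) eq = oneOut≢⊤ o (Vec.∷-injectiveʳ eq)

oneOut-above : (S : Subset k) → S ≢ ⊤ → ∃ λ F → OneOut F × S ⊆ F
oneOut-above []            S≢⊤ = contradiction refl S≢⊤
oneOut-above (outside ∷ S) S≢⊤ = outside ∷ ⊤ , here , s⊆s ⊆⊤
oneOut-above (inside ∷ S)  S≢⊤ with oneOut-above S (S≢⊤ ∘ cong (inside ∷_))
... | F , o , S⊆F = inside ∷ F , there o , s⊆s S⊆F

oneOut-maximal : {F T : Subset k} → OneOut F → T ≢ ⊤ → F ⊆ T → T ⊆ F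
oneOut-maximal {T = inside ∷ T}  here      T≢⊤ F⊆T =
  contradiction (cong (inside ∷_) (⊤⊆⇒≡ (drop-∷-⊆ F⊆T))) T≢⊤
oneOut-maximal {T = outside ∷ T} here      T≢⊤ F⊆T = s⊆s ⊆⊤
oneOut-maximal {T = inside ∷ T}  (there o) T≢⊤ F⊆T =
  s⊆s (oneOut-maximal o (T≢⊤ ∘ cong (inside ∷_)) (drop-∷-⊆ F⊆T))
oneOut-maximal {T = outside ∷ T} (there o) T≢⊤ F⊆T with F⊆T here
... | ()

++-⊆⁺ : {A A′ : Subset k} {B B′ : Subset l} → A ⊆ A′ → B ⊆ B′ → A ++ B ⊆ A′ ++ B′
++-⊆⁺ {A = []}          {[]}     A⊆A′ B⊆B′ = B⊆B′
++-⊆⁺ {A = outside ∷ A} {_ ∷ A′} A⊆A′ B⊆B′ = out⊆ (++-⊆⁺ (drop-∷-⊆ A⊆A′) B⊆B′)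
++-⊆⁺ {A = inside ∷ A}  {_ ∷ A′} A⊆A′ B⊆B′ with A⊆A′ here
... | here = s⊆s (++-⊆⁺ (drop-∷-⊆ A⊆A′) B⊆B′)

++-⊆⁻ : {A A′ : Subset k} {B B′ : Subset l} → A ++ B ⊆ A′ ++ B′ → A ⊆ A′ × B ⊆ B′
++-⊆⁻ {A = []}          {[]}     S⊆T = ⊆-refl , S⊆T
++-⊆⁻ {A = outside ∷ A} {_ ∷ A′} S⊆T = let A⊆A′ , B⊆B′ = ++-⊆⁻ (drop-∷-⊆ S⊆T) in
  out⊆ A⊆A′ , B⊆B′
++-⊆⁻ {A = inside ∷ A}  {_ ∷ A′} S⊆T with S⊆T here
... | here = let A⊆A′ , B⊆B′ = ++-⊆⁻ (drop-∷-⊆ S⊆T) in s⊆s A⊆A′ , B⊆B′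

∁⊤≡⊥ : ∀ k → ∁ (⊤ {k}) ≡ ⊥
∁⊤≡⊥ k = Vec.map-replicate not inside k

∁≡⊥⇒≡⊤ : (S : Subset k) → ∁ S ≡ ⊥ → S ≡ ⊤
∁≡⊥⇒≡⊤ []           _  = refl
∁≡⊥⇒≡⊤ (inside ∷ S) eq = cong (inside ∷_) (∁≡⊥⇒≡⊤ S (Vec.∷-injectiveʳ eq))

module _ {m n : ℕ} where
  -- The complement of `S ++ T` is a face of the disjoint union exactly when it misses one of the
  -- two blocks.
  D-face⁻ : {S : Subset (suc m)} {T : Subset (suc n)} → Face (D m n) (S ++ T) → S ≢ ⊤ × T ≢ ⊤
  D-face⁻ {S} {T} face =
    (λ { refl → face (inj₂ (∁ T , (⊤ , refl , ⊆⊤) ,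
      trans (Vec.map-++ not (⊤ {suc m}) T) (cong (_++ ∁ T) (∁⊤≡⊥ (suc m))))) }) ,
    (λ { refl → face (inj₁ (∁ S , (⊤ , refl , ⊆⊤) ,
      trans (Vec.map-++ not S (⊤ {suc n})) (cong (∁ S ++_) (∁⊤≡⊥ (suc n))))) })

  D-face⁺ : {S : Subset (suc m)} {T : Subset (suc n)} → S ≢ ⊤ → T ≢ ⊤ → Face (D m n) (S ++ T)
  D-face⁺ {S} {T} S≢⊤ T≢⊤ (inj₁ (U , _ , eq)) =
    T≢⊤ (∁≡⊥⇒≡⊤ T (Vec.++-injectiveʳ (∁ S) U (trans (sym (Vec.map-++ not S T)) eq)))
  D-face⁺ {S} {T} S≢⊤ T≢⊤ (inj₂ (U , _ , eq)) =
    S≢⊤ (∁≡⊥⇒≡⊤ S (Vec.++-injectiveˡ (∁ S) ⊥ (trans (sym (Vec.map-++ not S T)) eq)))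

  D-Family : Subset (suc m ℕ.+ suc n) → Set
  D-Family S = ∃ λ F₁ → ∃ λ F₂ → OneOut {suc m} F₁ × OneOut {suc n} F₂ × S ≡ F₁ ++ F₂

  D-facet⁻ : ∀ {S} → Facet (D m n) S → D-Family S
  D-facet⁻ {S} (face , max) with splitAt (suc m) S
  ... | A , B , refl with D-face⁻ face
  ...   | A≢⊤ , B≢⊤ with oneOut-above A A≢⊤ | oneOut-above B B≢⊤
  ...     | F₁ , o₁ , A⊆F₁ | F₂ , o₂ , B⊆F₂ = F₁ , F₂ , o₁ , o₂ , ⊆-antisym
              (++-⊆⁺ A⊆F₁ B⊆F₂)
              (max (F₁ ++ F₂) (D-face⁺ (oneOut≢⊤ o₁) (oneOut≢⊤ o₂)) (++-⊆⁺ A⊆F₁ B⊆F₂))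

  D-facet⁺ : ∀ {S} → D-Family S → Facet (D m n) S
  D-facet⁺ (F₁ , F₂ , o₁ , o₂ , refl) = D-face⁺ (oneOut≢⊤ o₁) (oneOut≢⊤ o₂) , maximal
    where
    maximal : ∀ T → Face (D m n) T → F₁ ++ F₂ ⊆ T → T ⊆ F₁ ++ F₂
    maximal T face F⊆T with splitAt (suc m) T
    ... | A , B , refl with D-face⁻ face | ++-⊆⁻ {A = F₁} {A′ = A} F⊆T
    ...   | A≢⊤ , B≢⊤ | F₁⊆A , F₂⊆B =
      ++-⊆⁺ (oneOut-maximal o₁ A≢⊤ F₁⊆A) (oneOut-maximal o₂ B≢⊤ F₂⊆B)

oneOut⇒row : {F : Subset k} → OneOut F → {d : Vec ℕ k} (e : Cell (select F d)) →
             ∃ λ s → ∀ x → marginal F e x ≡ ⟦ s ⟧ x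
oneOut⇒row here {n ∷ d} e = let i , eq = marginal-⊤ {d = d} e in
  here i , λ x → eq (λ i → sum {n} λ j → x (j ∷ i))
oneOut⇒row (there o) {n ∷ d} (j ∷ e) = let s , eq = oneOut⇒row o e in
  there j s , λ x → eq (x ∘ (j ∷_))

row⇒oneOut : {d : Vec ℕ k} (s : Row d) →
             ∃ λ F → OneOut F × ∃ λ (e : Cell (select F d)) → ∀ x → marginal F e x ≡ ⟦ s ⟧ x
row⇒oneOut {d = n ∷ d} (here i) = let e , eq = marginal-⊤⁻ i in
  outside ∷ ⊤ , here , e , λ x → eq (λ i → sum {n} λ j → x (j ∷ i))
row⇒oneOut (there j s) = let F , o , e , eq = row⇒oneOut s in
  inside ∷ F , there o , j ∷ e , λ x → eq (x ∘ (j ∷_))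

module _ {l : ℕ} {d₂ : Vec ℕ l} where
  -- Covers the vertices of the first block behind the omitted one: all of them are fixed, and only
  -- the second block is still summed.
  full⇒row : {F₂ : Subset l} → OneOut F₂ → (d : Vec ℕ k)
    (e : Cell (select (⊤ {k} ++ F₂) (d ++ d₂))) → ∃ λ i → ∃ λ s →
    ∀ x → marginal (⊤ {k} ++ F₂) {d ++ d₂} e x ≡ ⟦ s ⟧ (λ j → x (++⁺ {xs = d} i j))
  full⇒row o []      e       = let s , eq = oneOut⇒row o e in [] , s , eq
  full⇒row o (n ∷ d) (j ∷ e) = let i , s , eq = full⇒row o d e in
    j ∷ i , s , λ x → eq (x ∘ (j ∷_))

  oneOuts⇒rows : {F₁ : Subset k} {F₂ : Subset l} → OneOut F₁ → OneOut F₂ →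
    (d : Vec ℕ k) (e : Cell (select (F₁ ++ F₂) (d ++ d₂))) → ∃ λ r → ∃ λ s →
    ∀ x → marginal (F₁ ++ F₂) {d ++ d₂} e x ≡ ⟦ r ⟧ (λ i → ⟦ s ⟧ (λ j → x (++⁺ {xs = d} i j)))
  oneOuts⇒rows here o₂ (n ∷ d) e = let i , s , eq = full⇒row o₂ d e in
    -- `marginal` sums over the omitted vertex inside the row `s`, whereas `⟦ here i ⟧` sums over it
    -- outside.
    here i , s , λ x → trans (eq (λ i → sum {n} λ j → x (j ∷ i))) (⟦⟧-sum s (λ j h → x (h ∷ ++⁺ i j)))
  oneOuts⇒rows (there o₁) o₂ (n ∷ d) (h ∷ e) = let r , s , eq = oneOuts⇒rows o₁ o₂ d e in
    there h r , s , λ x → eq (x ∘ (h ∷_))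

  row⇒full : (s : Row d₂) → let F₂ , _ = row⇒oneOut s in {d : Vec ℕ k} (i : Cell d) →
    ∃ λ (e : Cell (select (⊤ {k} ++ F₂) (d ++ d₂))) →
    ∀ x → marginal (⊤ {k} ++ F₂) {d ++ d₂} e x ≡ ⟦ s ⟧ (λ j → x (++⁺ {xs = d} i j))
  row⇒full s []      = let _ , _ , e , eq = row⇒oneOut s in e , eq
  row⇒full s (j ∷ i) = let e , eq = row⇒full s i in j ∷ e , λ x → eq (x ∘ (j ∷_))

  rows⇒oneOuts : {d : Vec ℕ k} (r : Row d) (s : Row d₂) →
    let F₁ , _ = row⇒oneOut r ; F₂ , _ = row⇒oneOut s in
    ∃ λ (e : Cell (select (F₁ ++ F₂) (d ++ d₂))) →
    ∀ x → marginal (F₁ ++ F₂) {d ++ d₂} e x ≡ ⟦ r ⟧ (λ i → ⟦ s ⟧ (λ j → x (++⁺ {xs = d} i j)))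
  rows⇒oneOuts {d = n ∷ d} (here i) s = let e , eq = row⇒full s i in
    e , λ x → trans (eq (λ i → sum {n} λ j → x (j ∷ i))) (⟦⟧-sum s (λ j h → x (h ∷ ++⁺ i j)))
  rows⇒oneOuts (there h r) s = let e , eq = rows⇒oneOuts r s in
    h ∷ e , λ x → eq (x ∘ (h ∷_))

D-facets : ∀ {m n} (d₁ : Vec ℕ (suc m)) (d₂ : Vec ℕ (suc n)) →
           Marginals (Facet (D m n)) (d₁ ++ d₂) ≐ reindex ++↔ (Cuts d₁ d₂)
D-facets d₁ d₂ = ≐-trans (marginals-cong D-facet⁻ D-facet⁺) (equal
  (λ {x} x∈ r s → let F₁ , o₁ , _ = row⇒oneOut r ; F₂ , o₂ , _ = row⇒oneOut s
                      e , eq = rows⇒oneOuts r s in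
    trans (sym (eq x)) (x∈ (F₁ ++ F₂) (F₁ , F₂ , o₁ , o₂ , refl) e))
  (λ { {x} x∈ .(F₁ ++ F₂) (F₁ , F₂ , o₁ , o₂ , refl) e →
    let r , s , eq = oneOuts⇒rows o₁ o₂ d₁ e in trans (eq x) (x∈ r s) }))

-- Induction over the sequence of operations

⊤⊆⊤++⁻ : ∀ p {F : Subset k} → ⊤ {p ℕ.+ k} ⊆ ⊤ {p} ++ F → ⊤ ⊆ F
⊤⊆⊤++⁻ zero    ⊤⊆ = ⊤⊆
⊤⊆⊤++⁻ (suc p) ⊤⊆ = ⊤⊆⊤++⁻ p (drop-∷-⊆ ⊤⊆)

⊥++⊥ : ∀ k {l} → ⊥ {k ℕ.+ l} ≡ ⊥ {k} ++ ⊥ {l}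
⊥++⊥ zero    = refl
⊥++⊥ (suc k) = cong (outside ∷_) (⊥++⊥ k)

-- The invariant required by `Λ-facets`. It holds for `D m n` because the complement of `⊤` is
-- empty, and the empty set is a face of the disjoint union.
⊤-not-face : ∀ {m n} {C : Complex k} {W L} → Obtained m n C W L → ¬ Face C ⊤
⊤-not-face {m = m} {n} base face =
  face (inj₁ (⊥ , (⊤ , refl , ⊥⊆) , trans (∁⊤≡⊥ (suc m ℕ.+ suc n)) (⊥++⊥ (suc m))))
⊤-not-face (cone-step p {C} o) (_ , (F , (fF , _) , refl) , ⊤⊆) =
  ⊤-not-face o (subst (Face C) (⊤⊆⇒≡ (⊤⊆⊤++⁻ p ⊤⊆)) fF)
⊤-not-face (G-step o) (_ , _ , ())
⊤-not-face (Λ-step o) (_ , inj₁ refl , ⊤⊆) with ⊤⊆ here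
... | ()
⊤-not-face (Λ-step {C = C} o) (_ , inj₂ (F , (fF , _) , refl) , ⊤⊆) =
  ⊤-not-face o (subst (Face C) (⊤⊆⇒≡ (drop-∷-⊆ ⊤⊆)) fF)

AtLeast2 : Vec ℕ k → Set
AtLeast2 d = ∀ v → 2 ≤ lookup d v

BinaryOn : Subset k → Vec ℕ k → Set
BinaryOn S d = ∀ v → v ∈ S → lookup d v ≡ 2

lookup-drop : ∀ p (d : Vec ℕ (p ℕ.+ k)) v → lookup (drop p d) v ≡ lookup d (p ↑ʳ v)
lookup-drop zero    d       v = refl
lookup-drop (suc p) (_ ∷ d) v = lookup-drop p d v

atLeast2-drop : ∀ p (d : Vec ℕ (p ℕ.+ k)) → AtLeast2 d → AtLeast2 (drop p d)
atLeast2-drop p d d≥2 v = subst (2 ≤_) (sym (lookup-drop p d v)) (d≥2 (p ↑ʳ v))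

binaryOn-tail : ∀ {s} {S : Subset k} {d : Vec ℕ k} → BinaryOn (s ∷ S) (n ∷ d) → BinaryOn S d
binaryOn-tail bin v v∈ = bin (suc v) (there v∈)

binaryOn-outside : {S : Subset k} {d : Vec ℕ k} → BinaryOn S d → BinaryOn (outside ∷ S) (n ∷ d)
binaryOn-outside bin (suc v) (there v∈) = bin v v∈

binaryOn-drop⁺ : ∀ p {S : Subset k} (d : Vec ℕ (p ℕ.+ k)) →
                 BinaryOn (⊥ {p} ++ S) d → BinaryOn S (drop p d)
binaryOn-drop⁺ zero    d       bin = bin
binaryOn-drop⁺ (suc p) (_ ∷ d) bin = binaryOn-drop⁺ p d (binaryOn-tail bin)

binaryOn-drop⁻ : ∀ p {S : Subset k} (d : Vec ℕ (p ℕ.+ k)) →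
                 BinaryOn S (drop p d) → BinaryOn (⊥ {p} ++ S) d
binaryOn-drop⁻ zero    d       bin = bin
binaryOn-drop⁻ (suc p) (_ ∷ d) bin = binaryOn-outside (binaryOn-drop⁻ p d bin)

binary : (d : Vec ℕ k) → (∀ v → lookup d v ≡ 2) → Binary d
binary []      _  = []
binary (n ∷ d) eq = eq zero ∷ binary d (eq ∘ suc)

module _ {m n : ℕ} (d₁ : Vec ℕ (suc m)) (d₂ : Vec ℕ (suc n)) where
  D-minor : Minor (Marginals (Facet (D m n)) (d₁ ++ d₂)) (Cuts d₁ d₂)
  D-minor = minor-trans (≐⇒minor (D-facets d₁ d₂)) (reindex-minor ++↔ {Cuts d₁ d₂})

  regular-D : (∀ v → lookup (d₁ ++ d₂) v ≡ 2) → Regular (Marginals (Facet (D m n)) (d₁ ++ d₂))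
  regular-D d≡2 = regular-minor
    (minor-trans (minor-reindex ++↔ {Cuts d₁ d₂}) (≐⇒minor (≐-sym (D-facets d₁ d₂))))
    (regular-cuts
      (binary d₁ λ i → trans (sym (Vec.lookup-++ˡ d₁ d₂ i)) (d≡2 (i ↑ˡ suc n)))
      (binary d₂ λ i → trans (sym (Vec.lookup-++ʳ d₁ d₂ i)) (d≡2 (suc m ↑ʳ i))))

module _ {m n : ℕ} (d₁ : Vec ℕ (suc (suc m))) (d₂ : Vec ℕ (suc (suc n)))
         (d≥2 : AtLeast2 (d₁ ++ d₂)) where
  private
    d₁≥2 : AtLeast2 d₁
    d₁≥2 i = subst (2 ≤_) (Vec.lookup-++ˡ d₁ d₂ i) (d≥2 (i ↑ˡ _))

    d₂≥2 : AtLeast2 d₂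
    d₂≥2 i = subst (2 ≤_) (Vec.lookup-++ʳ d₁ d₂ i) (d≥2 (suc (suc m) ↑ʳ i))

    pair : ∀ {k} (d : Vec ℕ (suc (suc k))) → AtLeast2 d → Minor (Ends d) (Ends (2 ∷ 2 ∷ []))
    pair d d≥2 = ends-pair {d = d} d≥2 zero (d≥2 zero)

  D-binary-minor : Minor (Marginals (Facet (D (suc m) (suc n))) (d₁ ++ d₂))
                         (Cuts (2 ∷ 2 ∷ []) (2 ∷ 2 ∷ []))
  D-binary-minor = minor-trans (D-minor d₁ d₂) (cuts-minor (pair d₁ d₁≥2) (pair d₂ d₂≥2))

  regular-D⁻ : Regular (Marginals (Facet (D (suc m) (suc n))) (d₁ ++ d₂)) →
               ∀ v → lookup (d₁ ++ d₂) v ≡ 2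
  regular-D⁻ reg v = decidable-stable (lookup (d₁ ++ d₂) v ℕ.≟ 2)
    λ ≢2 → ternary v (ℕ.≤∧≢⇒< (d≥2 v) (≢-sym ≢2))
    where
    ternary : ∀ v → ¬ 3 ≤ lookup (d₁ ++ d₂) v
    ternary v rewrite Vec.lookup-splitAt (suc (suc m)) d₁ d₂ v with Fin.splitAt (suc (suc m)) v
    ... | inj₁ i = λ 3≤ → ternary-irregular (regular-minor
            (minor-trans (D-minor d₁ d₂) (cuts-minor (ends-pair {d = d₁} d₁≥2 i 3≤) (pair d₂ d₂≥2))) reg)
    -- For a vertex of the second block the blocks are interchanged, so that the same table applies.
    ... | inj₂ i = λ 3≤ → ternary-irregular (regular-minor
            (minor-trans (D-minor d₁ d₂) (minor-trans cuts-swap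
              (cuts-minor (ends-pair {d = d₂} d₂≥2 i 3≤) (pair d₁ d₁≥2)))) reg)

G-minor : (C : Complex k) {d : Vec ℕ k} → 1 ≤ n →
                  Minor (Marginals (Facet (G C)) (n ∷ d)) (Marginals (Facet C) d)
G-minor C {d} (s≤s z≤n) = minor-trans (≐⇒minor (G-facets C d))
  (minor-trans (reindex-minor cons↔ {Total _ (Marginals (Facet C) d)}) total-minor)

module _ {k n : ℕ} (C : Complex k) (¬⊤ : ¬ Face C ⊤) {d : Vec ℕ k} where
  Λ-minor : Minor (Marginals (Facet (Λ C)) (n ∷ d)) (Lawrence n (Marginals (Facet C) d))
  Λ-minor = minor-trans (≐⇒minor (Λ-facets C ¬⊤ d))
    (reindex-minor cons↔ {Lawrence n (Marginals (Facet C) d)})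

  Λ-minor⁻ : Minor (Lawrence n (Marginals (Facet C) d)) (Marginals (Facet (Λ C)) (n ∷ d))
  Λ-minor⁻ = minor-trans (minor-reindex cons↔ {Lawrence n (Marginals (Facet C) d)})
    (≐⇒minor (≐-sym (Λ-facets C ¬⊤ d)))

-- This feeds the argument for a Lawrence vertex with at least three values: lifting this minor with
-- `lawrence-cong` yields the space of `lift-irregular`. The bounds on `m` and `n` provide the two
-- vertices needed in each block.
obtained-minor : ∀ {m n} {C : Complex k} {W L} → 1 ≤ m → 1 ≤ n → Obtained m n C W L →
  ∀ {d} → AtLeast2 d → Minor (Marginals (Facet C) d) (Cuts (2 ∷ 2 ∷ []) (2 ∷ 2 ∷ []))
obtained-minor {m = m} (s≤s z≤n) (s≤s z≤n) base {d} d≥2 with splitAt (suc m) d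
... | d₁ , d₂ , refl = D-binary-minor d₁ d₂ d≥2
obtained-minor 1≤m 1≤n (cone-step p {C} o) {d} d≥2 = minor-trans (≐⇒minor (cone-facets p C d))
  (minor-trans (cone-minor p d d≥2) (obtained-minor 1≤m 1≤n o (atLeast2-drop p d d≥2)))
obtained-minor 1≤m 1≤n (G-step {C = C} o) {_ ∷ d} d≥2 =
  minor-trans (G-minor C (ℕ.<⇒≤ (d≥2 zero))) (obtained-minor 1≤m 1≤n o (d≥2 ∘ suc))
obtained-minor 1≤m 1≤n (Λ-step {C = C} o) {n ∷ d} d≥2 with d≥2 zero
... | s≤s (s≤s z≤n) = minor-trans (Λ-minor C (⊤-not-face o) {d})
  (minor-trans lawrence-minor (obtained-minor 1≤m 1≤n o (d≥2 ∘ suc)))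

regular⇒binary : ∀ {m n} {C : Complex k} {W L} → 1 ≤ m → 1 ≤ n → Obtained m n C W L →
  ∀ {d} → AtLeast2 d → Regular (Marginals (Facet C) d) → BinaryOn W d × BinaryOn L d
regular⇒binary {m = m} (s≤s z≤n) (s≤s z≤n) base {d} d≥2 reg with splitAt (suc m) d
... | d₁ , d₂ , refl = (λ v _ → regular-D⁻ d₁ d₂ d≥2 reg v) , λ v v∈⊥ → contradiction v∈⊥ ∉⊥
regular⇒binary 1≤m 1≤n (cone-step p {C} o) {d} d≥2 reg =
  let bW , bL = regular⇒binary 1≤m 1≤n o (atLeast2-drop p d d≥2)
        (regular-minor (minor-trans (≐⇒minor (cone-facets p C d)) (cone-minor p d d≥2)) reg)
  in binaryOn-drop⁻ p d bW , binaryOn-drop⁻ p d bL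
regular⇒binary 1≤m 1≤n (G-step {C = C} o) {_ ∷ d} d≥2 reg =
  let bW , bL = regular⇒binary 1≤m 1≤n o (d≥2 ∘ suc)
        (regular-minor (G-minor C (ℕ.<⇒≤ (d≥2 zero))) reg)
  in binaryOn-outside bW , binaryOn-outside bL
regular⇒binary 1≤m 1≤n (Λ-step {C = C} {L = L} o) {n ∷ d} d≥2 reg =
  binaryOn-outside (proj₁ tail-binary) , λ
    { zero    _          → decidable-stable (n ℕ.≟ 2) λ n≢2 →
        ternary (ℕ.≤∧≢⇒< (d≥2 zero) (≢-sym n≢2))
    ; (suc v) (there v∈) → proj₂ tail-binary v v∈ }
  where
  reg′ : Regular (Lawrence n (Marginals (Facet C) d))
  reg′ = regular-minor (Λ-minor C (⊤-not-face o) {d}) reg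

  ternary : ¬ 3 ≤ n
  ternary 3≤n = lift-irregular (regular-minor
    (lawrence-cong (truncate 3≤n) (obtained-minor 1≤m 1≤n o (d≥2 ∘ suc))) reg′)

  tail-binary : BinaryOn _ d × BinaryOn L d
  tail-binary with d≥2 zero
  ... | s≤s (s≤s z≤n) = regular⇒binary 1≤m 1≤n o (d≥2 ∘ suc)
    (regular-minor (lawrence-minor {K = Marginals (Facet C) d}) reg′)

binary⇒regular : ∀ {m n} {C : Complex k} {W L} → Obtained m n C W L →
  ∀ {d} → BinaryOn W d → BinaryOn L d → Regular (Marginals (Facet C) d)
binary⇒regular {m = m} base {d} bW bL with splitAt (suc m) d
... | d₁ , d₂ , refl = regular-D d₁ d₂ λ v → bW v ∈⊤
binary⇒regular (cone-step p {C} o) {d} bW bL = regular-minor (≐⇒minor (≐-sym (cone-facets p C d)))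
  (regular-cone p d (binary⇒regular o (binaryOn-drop⁺ p d bW) (binaryOn-drop⁺ p d bL)))
binary⇒regular (G-step {C = C} o) {n ∷ d} bW bL = regular-minor
  (minor-trans (minor-reindex cons↔ {Total n (Marginals (Facet C) d)}) (≐⇒minor (≐-sym (G-facets C d))))
  (regular-total _≟_ {Marginals (Facet C) d}
    (binary⇒regular o (binaryOn-tail bW) (binaryOn-tail bL)))
binary⇒regular (Λ-step {C = C} o) {n ∷ d} bW bL with bL zero here
... | refl = regular-minor (Λ-minor⁻ C (⊤-not-face o) {d})
  (regular-lawrence {K = Marginals (Facet C) d}
    (binary⇒regular o (binaryOn-tail bW) (binaryOn-tail bL)))

theorem7p10 : ∀ {m n N : ℕ} → 1 ≤ m → 1 ≤ n →
    ∀ (C : Complex N) (W L : Subset N) → Obtained m n C W L →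
    ∀ (d : Vec ℕ N) → (∀ v → 2 ≤ lookup d v) →
    Unimodular (𝒜 C d) ⇔
    ((∀ v → v ∈ W → lookup d v ≡ 2) × (∀ v → v ∈ L → lookup d v ≡ 2))
theorem7p10 1≤m 1≤n C W L o d d≥2 = mk⇔
  (λ uni → regular⇒binary 1≤m 1≤n o d≥2
    (regular-minor (≐⇒minor (kernel≐marginals C d)) (unimodular⇒regular (𝒜 C d) uni)))
  λ (bW , bL) → regular⇒unimodular (𝒜 C d)
    (regular-minor (≐⇒minor (≐-sym (kernel≐marginals C d))) (binary⇒regular o bW bL))
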